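{- Let $s$ be a real number with $\frac32<s\le 2$, let $\alpha,\beta>0$ be fixed, and let $K>0$. Suppose that for each $n$ (in an infinite set of natural numbers) $P_n\subset[0,1]^2$ is a set of $n$ points that is $s$-adaptable with constant $K$. Then there exist constants $C,N>0$, independent of $n$, such that for all such $n>N$, $$|\Pi_{\alpha,\beta}(P_n)|\le C\, n^{\frac43+\frac1s}\log n .$$
   Context: For a finite set $P\subset\mathbb R^2$ and real numbers $\alpha,\beta$, define the set of ordered triples $$\Pi_{\alpha,\beta}(P)=\{(p,q,r)\in P\times P\times P:\ p\cdot q=\alpha \text{ and } p\cdot r=\beta\},$$ where $\cdot$ is the standard dot product on $\mathbb R^2$ (the points $p,q,r$ need not be distinct). A set $P\subset[0,1]^2$ of $n$ points is called $s$-adaptable with constant $K$ if it satisfies (energy) $\displaystyle \frac{1}{\binom n2}\sum_{p,q\in P,\ p\neq q}|p-q|^{ -s}\le K$, and (separation) $\min\{|p-q|:\ p,q\in P,\ p\neq q\}\ge n^{ -1/s}$, where $|\cdot|$ is the Euclidean norm. -}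

module Defs where

open import Algebra.Bundles using (CommutativeRing)
import Algebra.Definitions.RawMonoid as RawMonoid
open import Data.List.Base using (List; length; map; foldr; filter; cartesianProduct)
import Data.List.Membership.Setoid as Membership
import Data.List.Relation.Unary.Unique.Setoid as Uniqueness
open import Data.Nat.Base as ℕ using (ℕ)
open import Data.Nat.Combinatorics using (_C_)
open import Data.Product.Base using (_×_; _,_; ∃; ∃-syntax; uncurry)
open import Data.Product.Relation.Binary.Pointwise.NonDependent using (×-decSetoid)
open import Level using (0ℓ; suc)
open import Relation.Binary.Bundles using (DecTotalOrder; DecSetoid)
open import Relation.Binary.Core using (Rel)
import Relation.Binary.Properties.DecTotalOrder as DecTotalOrderProperties
open import Relation.Binary.PropositionalEquality.Core using (_≡_)
open import Relation.Binary.Structures using (IsDecTotalOrder)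
open import Relation.Nullary.Decidable using (yes; no; ¬?; _×-dec_)
open import Relation.Unary using (Pred; Satisfiable; _∈_)

-- The classical real numbers, axiomatised as a Dedekind-complete ordered field.
-- The value of _⁻¹ at 0# is unspecified.
record CompleteOrderedField : Set (suc 0ℓ) where
  field
    commutativeRing : CommutativeRing 0ℓ 0ℓ

  open CommutativeRing commutativeRing public

  infix  4 _≤_
  infix  8 _⁻¹

  field
    _≤_             : Rel Carrier 0ℓ
    isDecTotalOrder : IsDecTotalOrder _≈_ _≤_
    0≉1             : 0# ≉ 1#
    _⁻¹             : Carrier → Carrier
    ⁻¹-inverseʳ     : ∀ x → x ≉ 0# → x * x ⁻¹ ≈ 1#
    +-monoˡ-≤       : ∀ z {x y} → x ≤ y → x + z ≤ y + z
    *-nonNeg        : ∀ {x y} → 0# ≤ x → 0# ≤ y → 0# ≤ x * y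

  UpperBound : Pred Carrier 0ℓ → Pred Carrier 0ℓ
  UpperBound S u = ∀ x → x ∈ S → x ≤ u

  field
    complete : (S : Pred Carrier 0ℓ) → Satisfiable S → Satisfiable (UpperBound S) →
               ∃[ u ] (u ∈ UpperBound S × (∀ v → v ∈ UpperBound S → u ≤ v))

  decTotalOrder : DecTotalOrder 0ℓ 0ℓ 0ℓ
  decTotalOrder = record { isDecTotalOrder = isDecTotalOrder }

  open IsDecTotalOrder isDecTotalOrder public
    using (_≟_; _≤?_)

  open DecTotalOrderProperties decTotalOrder public
    using (_<_)

-- The laws determine both functions: a homomorphism from addition to
-- multiplication with 1 + x ≤ exp x can only be the exponential function, and
-- log is its inverse on the positive reals (unspecified elsewhere).
record Reals : Set (suc 0ℓ) where
  field
    completeOrderedField : CompleteOrderedField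

  open CompleteOrderedField completeOrderedField public
    renaming (Carrier to ℝ)

  field
    exp log  : ℝ → ℝ
    exp-cong : ∀ {x y} → x ≈ y → exp x ≈ exp y
    exp-+    : ∀ x y → exp (x + y) ≈ exp x * exp y
    1+x≤exp  : ∀ x → 1# + x ≤ exp x
    exp-log  : ∀ {x} → 0# < x → exp (log x) ≈ x

module RealGeometry (reals : Reals) where
  open Reals reals

  infixl 7 _/_
  infixr 8 _^_
  infixl 7 _·_

  fromℕ : ℕ → ℝ
  fromℕ n = RawMonoid._×_ +-rawMonoid n 1#

  _/_ : ℝ → ℝ → ℝ
  x / y = x * y ⁻¹

  -- Real power; meaningful for a positive base only.
  _^_ : ℝ → ℝ → ℝ
  x ^ y = exp (y * log x)

  √_ : ℝ → ℝ
  √ x with x ≤? 0#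
  ... | yes _ = 0#
  ... | no  _ = x ^ (1# / fromℕ 2)

  sum : List ℝ → ℝ
  sum = foldr _+_ 0#

  pointDecSetoid : DecSetoid 0ℓ 0ℓ
  pointDecSetoid = ×-decSetoid ℝ-decSetoid ℝ-decSetoid
    where ℝ-decSetoid = DecTotalOrder.Eq.decSetoid decTotalOrder

  open DecSetoid pointDecSetoid public
    using () renaming (Carrier to Point; _≉_ to _≉ₚ_; _≟_ to _≟ₚ_; setoid to pointSetoid)

  open Membership pointSetoid public
    using () renaming (_∈_ to _∈ₚ_)

  open Uniqueness pointSetoid public
    using (Unique)

  record FinitePointSet : Set where
    field
      points : List Point
      unique : Unique points

    size : ℕ
    size = length points

  open FinitePointSet public

  _·_ : Point → Point → ℝ
  (x₁ , y₁) · (x₂ , y₂) = x₁ * x₂ + y₁ * y₂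

  _-ₚ_ : Point → Point → Point
  (x₁ , y₁) -ₚ (x₂ , y₂) = x₁ - x₂ , y₁ - y₂

  norm : Point → ℝ
  norm p = √ (p · p)

  dist : Point → Point → ℝ
  dist p q = norm (p -ₚ q)

  InUnitSquare : Point → Set
  InUnitSquare (x , y) = (0# ≤ x × x ≤ 1#) × (0# ≤ y × y ≤ 1#)

  -- Without repetitions up to _≈_, since the points of P are distinct; hence
  -- its length is the number of such triples.
  Π : ℝ → ℝ → FinitePointSet → List (Point × Point × Point)
  Π α β P =
    filter (λ (p , q , r) → (p · q ≟ α) ×-dec (p · r ≟ β))
      (cartesianProduct (points P) (cartesianProduct (points P) (points P)))

  distinctPairs : FinitePointSet → List (Point × Point)
  distinctPairs P =
    filter (λ (p , q) → ¬? (p ≟ₚ q)) (cartesianProduct (points P) (points P))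

  -- For n < 2 there are no pairs of distinct points, so energy holds as 0 ≤ K
  -- (whatever 0# ⁻¹ is) and separation holds vacuously.
  record IsAdaptable (s K : ℝ) (n : ℕ) (P : FinitePointSet) : Set where
    field
      size≡n       : size P ≡ n
      inUnitSquare : ∀ p → p ∈ₚ points P → InUnitSquare p
      energy       : fromℕ (n C 2) ⁻¹
                       * sum (map (uncurry λ p q → dist p q ^ (- s)) (distinctPairs P)) ≤ K
      separation   : ∀ p q → p ∈ₚ points P → q ∈ₚ points P → p ≉ₚ q →
                     fromℕ n ^ (- (1# / s)) ≤ dist p q

Infinite : Pred ℕ 0ℓ → Set
Infinite I = ∀ m → ∃ λ n → m ℕ.< n × n ∈ I

module Submission where

-- Let a(p) be the number of points of P on the line p · q = α, and cut the unit
-- square into M strips of width 1/M, horizontal or vertical so that two points of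
-- the line in one strip are within √2/M of each other. By Cauchy–Schwarz over the
-- strips, a(p)² ≤ M (a(p) + c(p)), hence a(p)² ≤ M² + 2 M c(p), where c(p) counts the
-- pairs of distinct points on the line at distance at most √2/M. Two distinct points
-- lie on at most one such line, so ∑ a(p)² ≤ n M² + 2 M E, where E is the number of
-- pairs of distinct points of P at distance at most √2/M; the energy condition gives
-- E ≤ 2 K n² M⁻ˢ. With M ≈ n^(1/3) both terms are at most of order n^(4/3 + 1/s), and
-- |Π α β| = ∑ a(p) b(p) ≤ ∑ a(p)² + ∑ b(p)², with b the analogue of a for β.

open import Defs
open import Algebra.Bundles using (CommutativeRing)
import Algebra.Definitions.RawMonoid as RawMonoid
import Algebra.Properties.AbelianGroup as AbelianGroupProperties
import Algebra.Properties.Ring as RingProperties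
import Algebra.Properties.Semiring.Mult as Mult
import Algebra.Solver.Ring as RingSolver
open import Algebra.Solver.Ring.AlmostCommutativeRing
  using (fromCommutativeRing; _-Raw-AlmostCommutative⟶_)
open import Data.Bool.Base using (if_then_else_)
open import Data.Integer.Base as ℤ using (ℤ; +_; -[1+_]; _⊖_)
import Data.Integer.Properties as ℤₚ
open import Data.List.Base using (List; []; _∷_; length; map; filter; cartesianProduct; upTo; _++_)
open import Data.List.Membership.Propositional using () renaming (_∈_ to _∈ˡ_)
open import Data.List.Membership.Propositional.Properties using (∈-upTo⁺)
open import Data.List.Properties using (map-++; map-∘; length-upTo)
open import Data.List.Relation.Unary.All as All using (All; []; _∷_)
open import Data.List.Relation.Unary.All.Properties using (all-filter)
open import Data.List.Relation.Unary.AllPairs using ([]; _∷_)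
open import Data.List.Relation.Unary.Any using (here; there)
open import Data.List.Relation.Unary.Unique.Propositional.Properties using (upTo⁺)
import Data.List.Relation.Unary.Unique.Setoid as UniqueSetoid
open import Data.Maybe.Base as Maybe using (Maybe)
open import Data.Nat.Base as ℕ using (ℕ; zero; suc)
open import Data.Nat.Combinatorics using (_C_; nC1≡n; nCk+nC[k+1]≡[n+1]C[k+1])
import Data.Nat.ListAction as ℕL
open import Data.Nat.ListAction.Properties using (sum-++)
import Data.Nat.Properties as ℕₚ
open import Data.Nat.Tactic.RingSolver using (solve-∀)
open import Data.Product.Base using (_×_; _,_; proj₁; proj₂; ∃-syntax; uncurry)
import Data.Sign.Base as Sign
open import Data.Sum.Base using (inj₁; inj₂)
open import Function.Base using (_∘_)
open import Level using (Level; 0ℓ)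
open import Relation.Binary.Bundles using (DecSetoid; Setoid)
open import Relation.Binary.PropositionalEquality.Core as ≡ using (_≡_)
import Relation.Binary.PropositionalEquality.Properties as ≡ₚ
import Relation.Binary.Reasoning.Setoid as SetoidReasoning
open import Relation.Binary.Structures using (IsDecTotalOrder)
open import Relation.Nullary.Decidable using (Dec; yes; no; does; dec⇒maybe; ¬?; _×-dec_)
open import Relation.Nullary.Negation.Core using (¬_; contradiction)
open import Relation.Unary using (Pred; Decidable; _∈_)

-- Finite sums of natural numbers and indicators.

module Counting where

  private
    variable
      a b p q : Level
      A B : Set a

  open import Data.Nat.Base using (suc; _+_; _*_; _≤_; _<_; z≤n; s≤s)
  open ℕₚ.≤-Reasoning

  ∑ : List A → (A → ℕ) → ℕ
  ∑ xs f = ℕL.sum (map f xs)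

  infix 5 ∑
  syntax ∑ xs (λ x → e) = ∑[ x ← xs ] e

  𝟙 : {P : Set p} → Dec P → ℕ
  𝟙 P? = if does P? then 1 else 0

  𝟙-yes : {P : Set p} (P? : Dec P) → P → 1 ≤ 𝟙 P?
  𝟙-yes (yes _) _ = ℕₚ.≤-refl
  𝟙-yes (no ¬P) P = contradiction P ¬P

  𝟙-× : {P : Set p} {Q : Set q} (P? : Dec P) (Q? : Dec Q) → 𝟙 (P? ×-dec Q?) ≡ 𝟙 P? * 𝟙 Q?
  𝟙-× (yes _) (yes _) = ≡.refl
  𝟙-× (yes _) (no _)  = ≡.refl
  𝟙-× (no _)  _       = ≡.refl

  ∑-cong : (xs : List A) {f g : A → ℕ} → (∀ x → f x ≡ g x) → ∑ xs f ≡ ∑ xs g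
  ∑-cong []       f≗g = ≡.refl
  ∑-cong (x ∷ xs) f≗g = ≡.cong₂ _+_ (f≗g x) (∑-cong xs f≗g)

  ∑-mono-All : {xs : List A} {f g : A → ℕ} → All (λ x → f x ≤ g x) xs → ∑ xs f ≤ ∑ xs g
  ∑-mono-All []        = z≤n
  ∑-mono-All (f≤g ∷ h) = ℕₚ.+-mono-≤ f≤g (∑-mono-All h)

  ∑-mono : (xs : List A) {f g : A → ℕ} → (∀ x → f x ≤ g x) → ∑ xs f ≤ ∑ xs g
  ∑-mono xs f≤g = ∑-mono-All (All.universal f≤g xs)

  ∑-+ : (xs : List A) (f g : A → ℕ) → (∑[ x ← xs ] (f x + g x)) ≡ ∑ xs f + ∑ xs g
  ∑-+ []       f g = ≡.refl
  ∑-+ (x ∷ xs) f g rewrite ∑-+ xs f g = +-interchange (f x) (g x) (∑ xs f) (∑ xs g)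
    where
    +-interchange : ∀ k l m n → (k + l) + (m + n) ≡ (k + m) + (l + n)
    +-interchange = solve-∀

  ∑-*ˡ : ∀ c (xs : List A) (f : A → ℕ) → (∑[ x ← xs ] (c * f x)) ≡ c * ∑ xs f
  ∑-*ˡ c []       f = ≡.sym (ℕₚ.*-zeroʳ c)
  ∑-*ˡ c (x ∷ xs) f rewrite ∑-*ˡ c xs f = ≡.sym (ℕₚ.*-distribˡ-+ c (f x) (∑ xs f))

  ∑-const : (xs : List A) (c : ℕ) → (∑[ _ ← xs ] c) ≡ length xs * c
  ∑-const []       c = ≡.refl
  ∑-const (x ∷ xs) c = ≡.cong₂ _+_ ≡.refl (∑-const xs c)

  ∑-swap : (xs : List A) (ys : List B) (f : A → B → ℕ) →
           (∑[ x ← xs ] ∑[ y ← ys ] f x y) ≡ (∑[ y ← ys ] ∑[ x ← xs ] f x y)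
  ∑-swap []       ys f = ≡.sym (≡.trans (∑-const ys 0) (ℕₚ.*-zeroʳ (length ys)))
  ∑-swap (x ∷ xs) ys f rewrite ∑-swap xs ys f = ≡.sym (∑-+ ys (f x) λ y → ∑[ x ← xs ] f x y)

  ∑-* : (xs : List A) (ys : List B) (f : A → ℕ) (g : B → ℕ) →
        ∑ xs f * ∑ ys g ≡ (∑[ x ← xs ] ∑[ y ← ys ] (f x * g y))
  ∑-* []       ys f g = ≡.refl
  ∑-* (x ∷ xs) ys f g rewrite ℕₚ.*-distribʳ-+ (∑ ys g) (f x) (∑ xs f) =
    ≡.cong₂ _+_ (≡.sym (∑-*ˡ (f x) ys g)) (∑-* xs ys f g)

  ∑-++ : (xs ys : List A) (f : A → ℕ) → ∑ (xs ++ ys) f ≡ ∑ xs f + ∑ ys f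
  ∑-++ xs ys f = ≡.trans (≡.cong ℕL.sum (map-++ f xs ys)) (sum-++ (map f xs) (map f ys))

  ∑-cartesianProduct : (xs : List A) (ys : List B) (f : A × B → ℕ) →
                       ∑ (cartesianProduct xs ys) f ≡ (∑[ x ← xs ] ∑[ y ← ys ] f (x , y))
  ∑-cartesianProduct []       ys f = ≡.refl
  ∑-cartesianProduct (x ∷ xs) ys f = ≡.trans
    (∑-++ (map (x ,_) ys) (cartesianProduct xs ys) f)
    (≡.cong₂ _+_ (≡.cong ℕL.sum (≡.sym (map-∘ ys))) (∑-cartesianProduct xs ys f))

  ∑-filter : {P : Pred A p} (P? : Decidable P) (xs : List A) (f : A → ℕ) →
             ∑ (filter P? xs) f ≡ (∑[ x ← xs ] (𝟙 (P? x) * f x))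
  ∑-filter P? []       f = ≡.refl
  ∑-filter P? (x ∷ xs) f with P? x
  ... | yes _ = ≡.cong₂ _+_ (≡.sym (ℕₚ.*-identityˡ (f x))) (∑-filter P? xs f)
  ... | no _  = ∑-filter P? xs f

  length-filter : {P : Pred A p} (P? : Decidable P) (xs : List A) →
                  length (filter P? xs) ≡ (∑[ x ← xs ] 𝟙 (P? x))
  length-filter P? []       = ≡.refl
  length-filter P? (x ∷ xs) with P? x
  ... | yes _ = ≡.cong suc (length-filter P? xs)
  ... | no _  = length-filter P? xs

  ∑-𝟙-≥1 : {P : Pred A p} (P? : Decidable P) {xs : List A} {x : A} → x ∈ˡ xs → P x →
           1 ≤ (∑[ y ← xs ] 𝟙 (P? y))
  ∑-𝟙-≥1 P? (here ≡.refl) Px = ℕₚ.≤-trans (𝟙-yes (P? _) Px) (ℕₚ.m≤m+n _ _)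
  ∑-𝟙-≥1 P? (there x∈xs)  Px = ℕₚ.≤-trans (∑-𝟙-≥1 P? x∈xs Px) (ℕₚ.m≤n+m _ _)

  ∑-𝟙-none : {P : Pred A p} (P? : Decidable P) {xs : List A} → All (λ x → ¬ P x) xs →
             (∑[ x ← xs ] 𝟙 (P? x)) ≡ 0
  ∑-𝟙-none P? []               = ≡.refl
  ∑-𝟙-none P? (_∷_ {x} ¬Px h) with P? x
  ... | yes Px = contradiction Px ¬Px
  ... | no _   = ∑-𝟙-none P? h

  module _ (S : Setoid a b) where
    open Setoid S using (Carrier; _≈_; _≉_)
    open UniqueSetoid S using (Unique)

    -- After a first hit the tail contributes nothing, since its members differ from the hit and `P`
    -- holds for one point at most. With `c` in place of 1 the bound can be another indicator, which
    -- may be 0 when `P` never holds.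
    ∑-𝟙-unique : {P : Pred Carrier p} (P? : Decidable P) {xs : List Carrier} {c : ℕ} → Unique xs →
                 (∀ {x y} → P x → P y → x ≈ y) → (∀ {x} → P x → 1 ≤ c) →
                 (∑[ x ← xs ] 𝟙 (P? x)) ≤ c
    ∑-𝟙-unique P? [] _ _ = z≤n
    ∑-𝟙-unique {P = P} P? {x ∷ xs} (x∉xs ∷ xs!) P-unique P⇒1≤c with P? x
    ... | no _   = ∑-𝟙-unique P? xs! P-unique P⇒1≤c
    ... | yes Px rewrite ∑-𝟙-none P? (All.map (λ x≉y Py → x≉y (P-unique Px Py)) x∉xs) = P⇒1≤c Px

  -- With the larger number written as the smaller plus `k`, the two sides differ by exactly
  -- `k * k`; no subtraction in ℕ occurs.
  2*m*n≤m²+n² : ∀ m n → 2 * (m * n) ≤ m * m + n * n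
  2*m*n≤m²+n² m n with ℕₚ.≤-total m n
  ... | inj₁ m≤n with k , ≡.refl ← ℕₚ.m≤n⇒∃[o]m+o≡n m≤n = begin
    2 * (m * (m + k))          ≤⟨ ℕₚ.m≤m+n _ (k * k) ⟩
    2 * (m * (m + k)) + k * k  ≡⟨ square m k ⟩
    m * m + (m + k) * (m + k)  ∎
    where
    square : ∀ m k → 2 * (m * (m + k)) + k * k ≡ m * m + (m + k) * (m + k)
    square = solve-∀
  ... | inj₂ n≤m with k , ≡.refl ← ℕₚ.m≤n⇒∃[o]m+o≡n n≤m = begin
    2 * ((n + k) * n)          ≤⟨ ℕₚ.m≤m+n _ (k * k) ⟩
    2 * ((n + k) * n) + k * k  ≡⟨ square n k ⟩
    (n + k) * (n + k) + n * n  ∎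
    where
    square : ∀ n k → 2 * ((n + k) * n) + k * k ≡ (n + k) * (n + k) + n * n
    square = solve-∀

  m*n≤m²+n² : ∀ m n → m * n ≤ m * m + n * n
  m*n≤m²+n² m n = ℕₚ.≤-trans (ℕₚ.m≤m+n (m * n) _) (2*m*n≤m²+n² m n)

  ∑-cauchySchwarz : (xs : List A) (f : A → ℕ) →
                    ∑ xs f * ∑ xs f ≤ length xs * (∑[ x ← xs ] (f x * f x))
  ∑-cauchySchwarz []       f = z≤n
  ∑-cauchySchwarz (x ∷ xs) f = begin
    (f x + S) * (f x + S)                      ≡⟨ expand (f x) S ⟩
    f x * f x + 2 * (f x * S) + S * S
      ≤⟨ ℕₚ.+-mono-≤ (ℕₚ.+-monoʳ-≤ (f x * f x) cross) (∑-cauchySchwarz xs f) ⟩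
    f x * f x + (l * (f x * f x) + Q) + l * Q  ≡⟨ collect (f x) l Q ⟩
    suc l * (f x * f x + Q)                    ∎
    where
    S Q l : ℕ
    S = ∑ xs f
    Q = ∑[ y ← xs ] (f y * f y)
    l = length xs
    expand : ∀ m n → (m + n) * (m + n) ≡ m * m + 2 * (m * n) + n * n
    expand = solve-∀
    collect : ∀ m l Q → m * m + (l * (m * m) + Q) + l * Q ≡ suc l * (m * m + Q)
    collect = solve-∀
    -- The cross terms of the square are bounded one by one, by 2ab ≤ a² + b².
    cross : 2 * (f x * S) ≤ l * (f x * f x) + Q
    cross = begin
      2 * (f x * S)                       ≡⟨ ≡.cong (2 *_) (∑-*ˡ (f x) xs f) ⟨
      2 * (∑[ y ← xs ] (f x * f y))       ≡⟨ ∑-*ˡ 2 xs _ ⟨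
      (∑[ y ← xs ] (2 * (f x * f y)))     ≤⟨ ∑-mono xs (λ y → 2*m*n≤m²+n² (f x) (f y)) ⟩
      (∑[ y ← xs ] (f x * f x + f y * f y))
        ≡⟨ ∑-+ xs (λ _ → f x * f x) (λ y → f y * f y) ⟩
      (∑[ _ ← xs ] (f x * f x)) + Q       ≡⟨ ≡.cong (_+ Q) (∑-const xs (f x * f x)) ⟩
      l * (f x * f x) + Q                 ∎

  -- Double counting of pairs of points over lines and strips.

  -- p ∋ q says that q lies on the p-th line, which strip p cuts into M pieces.
  module Strips (S : DecSetoid 0ℓ 0ℓ) where

    open DecSetoid S using (Carrier; _≈_; _≉_; _≟_; setoid)

    module _
      {_∋_ : Carrier → Carrier → Set} (_∋?_ : ∀ p q → Dec (p ∋ q))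
      {Close : Carrier × Carrier → Set} (close? : Decidable Close)
      {Good : Pred Carrier 0ℓ}
      (M : ℕ) (strip : Carrier → Carrier → ℕ)
      (strip<M : ∀ {p q} → Good p → Good q → strip p q < M)
      (same-strip : ∀ {p q r} → Good p → Good q → Good r → p ∋ q → p ∋ r →
                    strip p q ≡ strip p r → Close (q , r))
      (two-points : ∀ {p p′ q r} → q ≉ r → p ∋ q → p ∋ r → p′ ∋ q → p′ ∋ r → p ≈ p′)
      {xs : List Carrier} (xs! : UniqueSetoid.Unique setoid xs) (good : All Good xs)
      where

      richness : Carrier → ℕ
      richness p = ∑[ q ← xs ] 𝟙 (p ∋? q)

      close-pairs : ℕ
      close-pairs = length (filter close? (filter (λ (q , r) → ¬? (q ≟ r)) (cartesianProduct xs xs)))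

      private
        -- "Far" means only distinct: these are the pairs that `close-pairs` counts.
        far? : ∀ q r → Dec (q ≉ r × Close (q , r))
        far? q r = ¬? (q ≟ r) ×-dec close? (q , r)

        on? : ∀ p q r → Dec (p ∋ q × p ∋ r)
        on? p q r = (p ∋? q) ×-dec (p ∋? r)

        pairs : Carrier → ℕ
        pairs p = ∑[ q ← xs ] ∑[ r ← xs ] 𝟙 (far? q r ×-dec on? p q r)

        close-pairs-∑ : close-pairs ≡ (∑[ q ← xs ] ∑[ r ← xs ] 𝟙 (far? q r))
        close-pairs-∑ = begin-equality
          close-pairs
            ≡⟨ length-filter close? (filter _ (cartesianProduct xs xs)) ⟩
          ∑ (filter _ (cartesianProduct xs xs)) (𝟙 ∘ close?)
            ≡⟨ ∑-filter _ (cartesianProduct xs xs) _ ⟩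
          ∑ (cartesianProduct xs xs) (λ (q , r) → 𝟙 (¬? (q ≟ r)) * 𝟙 (close? (q , r)))
            ≡⟨ ∑-cartesianProduct xs xs _ ⟩
          (∑[ q ← xs ] ∑[ r ← xs ] (𝟙 (¬? (q ≟ r)) * 𝟙 (close? (q , r))))
            ≡⟨ ∑-cong xs (λ q → ∑-cong xs λ r → 𝟙-× (¬? (q ≟ r)) (close? (q , r))) ⟨
          (∑[ q ← xs ] ∑[ r ← xs ] 𝟙 (far? q r)) ∎

        -- With the sum over `p` moved innermost, `two-points` leaves at most one line through each
        -- distinct pair.
        ∑-pairs : ∑ xs pairs ≤ close-pairs
        ∑-pairs = begin
          (∑[ p ← xs ] ∑[ q ← xs ] ∑[ r ← xs ] 𝟙 (far? q r ×-dec on? p q r))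
            ≡⟨ ∑-swap xs xs _ ⟩
          (∑[ q ← xs ] ∑[ p ← xs ] ∑[ r ← xs ] 𝟙 (far? q r ×-dec on? p q r))
            ≡⟨ ∑-cong xs (λ q → ∑-swap xs xs _) ⟩
          (∑[ q ← xs ] ∑[ r ← xs ] ∑[ p ← xs ] 𝟙 (far? q r ×-dec on? p q r))
            ≤⟨ ∑-mono xs (λ q → ∑-mono xs λ r →
                 ∑-𝟙-unique setoid (λ p → far? q r ×-dec on? p q r) xs!
                   (λ ((q≉r , _) , p∋q , p∋r) (_ , p′∋q , p′∋r) →
                     two-points q≉r p∋q p∋r p′∋q p′∋r)
                   (λ (far , _) → 𝟙-yes (far? q r) far)) ⟩
          (∑[ q ← xs ] ∑[ r ← xs ] 𝟙 (far? q r))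
            ≡⟨ close-pairs-∑ ⟨
          close-pairs ∎

        module _ {p : Carrier} (good-p : Good p) where

          in? : ∀ q i → Dec (p ∋ q × strip p q ≡ i)
          in? q i = (p ∋? q) ×-dec (strip p q ℕₚ.≟ i)

          piece : ℕ → ℕ
          piece i = ∑[ q ← xs ] 𝟙 (in? q i)

          -- Every point of the line lies in some strip with index below `M`, so it is counted by at
          -- least one piece.
          richness≤∑piece : richness p ≤ ∑ (upTo M) piece
          richness≤∑piece = begin
            richness p
              ≤⟨ ∑-mono-All (All.map (λ {q} good-q → some-piece q good-q) good) ⟩
            (∑[ q ← xs ] ∑[ i ← upTo M ] 𝟙 (in? q i))
              ≡⟨ ∑-swap xs (upTo M) _ ⟩
            ∑ (upTo M) piece ∎
            where
            some-piece : ∀ q → Good q → 𝟙 (p ∋? q) ≤ (∑[ i ← upTo M ] 𝟙 (in? q i))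
            some-piece q good-q with p ∋? q
            ... | no _    = z≤n
            ... | yes p∋q = ∑-𝟙-≥1 (λ i → yes p∋q ×-dec (strip p q ℕₚ.≟ i))
                              (∈-upTo⁺ (strip<M good-p good-q)) (p∋q , ≡.refl)

          -- The squares count ordered pairs of points of the line in a common strip. Equal points
          -- give `richness p`; distinct ones are close by `same-strip` and give `pairs p`.
          ∑piece² : (∑[ i ← upTo M ] (piece i * piece i)) ≤ richness p + pairs p
          ∑piece² = begin
            (∑[ i ← upTo M ] (piece i * piece i))
              ≡⟨ ∑-cong (upTo M) (λ i → ≡.trans (∑-* xs xs _ _)
                   (∑-cong xs λ q → ∑-cong xs λ r → ≡.sym (𝟙-× (in? q i) (in? r i)))) ⟩
            (∑[ i ← upTo M ] ∑[ q ← xs ] ∑[ r ← xs ] 𝟙 (in? q i ×-dec in? r i))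
              ≡⟨ ∑-swap (upTo M) xs _ ⟩
            (∑[ q ← xs ] ∑[ i ← upTo M ] ∑[ r ← xs ] 𝟙 (in? q i ×-dec in? r i))
              ≡⟨ ∑-cong xs (λ q → ∑-swap (upTo M) xs _) ⟩
            (∑[ q ← xs ] ∑[ r ← xs ] ∑[ i ← upTo M ] 𝟙 (in? q i ×-dec in? r i))
              -- For fixed `q` and `r` only `i = strip p q` can contribute, so the sum over `i` is
              -- at most 1, and `equal-or-far` says which indicator pays for it.
              ≤⟨ ∑-mono-All (All.map (λ {q} good-q →
                   ∑-mono-All (All.map (λ {r} good-r →
                     ∑-𝟙-unique (≡ₚ.setoid ℕ) (λ i → in? q i ×-dec in? r i) (upTo⁺ M)
                       (λ ((_ , ≡i) , _) ((_ , ≡j) , _) → ≡.trans (≡.sym ≡i) ≡j)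
                       (equal-or-far q r good-q good-r)) good)) good) ⟩
            (∑[ q ← xs ] ∑[ r ← xs ]
              (𝟙 ((p ∋? q) ×-dec (q ≟ r)) + 𝟙 (far? q r ×-dec on? p q r)))
              ≡⟨ ∑-cong xs (λ q → ∑-+ xs _ _) ⟩
            (∑[ q ← xs ] ((∑[ r ← xs ] 𝟙 ((p ∋? q) ×-dec (q ≟ r)))
                           + (∑[ r ← xs ] 𝟙 (far? q r ×-dec on? p q r))))
              ≡⟨ ∑-+ xs _ _ ⟩
            (∑[ q ← xs ] ∑[ r ← xs ] 𝟙 ((p ∋? q) ×-dec (q ≟ r))) + pairs p
              ≤⟨ ℕₚ.+-monoˡ-≤ (pairs p) (∑-mono xs λ q →
                   ∑-𝟙-unique setoid (λ r → (p ∋? q) ×-dec (q ≟ r)) xs!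
                     (λ (_ , q≈r) (_ , q≈r′) → ≈-trans (≈-sym q≈r) q≈r′)
                     (λ (p∋q , _) → 𝟙-yes (p ∋? q) p∋q)) ⟩
            richness p + pairs p ∎
            where
            open DecSetoid S using () renaming (trans to ≈-trans; sym to ≈-sym)
            equal-or-far : ∀ q r → Good q → Good r → ∀ {i} →
              (p ∋ q × strip p q ≡ i) × (p ∋ r × strip p r ≡ i) →
              1 ≤ 𝟙 ((p ∋? q) ×-dec (q ≟ r)) + 𝟙 (far? q r ×-dec on? p q r)
            equal-or-far q r good-q good-r ((p∋q , ≡i) , (p∋r , ≡i′)) = cases (q ≟ r)
              where
              cases : Dec (q ≈ r) → _
              cases (yes q≈r) = ℕₚ.≤-trans (𝟙-yes ((p ∋? q) ×-dec (q ≟ r)) (p∋q , q≈r))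
                                  (ℕₚ.m≤m+n _ _)
              cases (no q≉r)  = ℕₚ.≤-trans
                (𝟙-yes (far? q r ×-dec on? p q r)
                  ((q≉r , same-strip good-p good-q good-r p∋q p∋r (≡.trans ≡i (≡.sym ≡i′)))
                  , p∋q , p∋r))
                (ℕₚ.m≤n+m _ _)

          -- Cauchy-Schwarz gives R² ≤ M (R + c). Doubling it and using 2MR ≤ M² + R² leaves a
          -- surplus R² on the right, which is cancelled.
          richness² : richness p * richness p ≤ M * M + 2 * M * pairs p
          richness² = ℕₚ.+-cancelʳ-≤ (R * R) _ _ (begin
            R * R + R * R                       ≡⟨ double R ⟩
            2 * (R * R)                         ≤⟨ ℕₚ.*-monoʳ-≤ 2 R²≤ ⟩
            2 * (M * (R + pairs p))             ≡⟨ distrib M R (pairs p) ⟩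
            2 * (M * R) + 2 * M * pairs p       ≤⟨ ℕₚ.+-monoˡ-≤ _ (2*m*n≤m²+n² M R) ⟩
            M * M + R * R + 2 * M * pairs p     ≡⟨ reorder (M * M) (R * R) (2 * M * pairs p) ⟩
            M * M + 2 * M * pairs p + R * R     ∎)
            where
            R : ℕ
            R = richness p
            double : ∀ n → n * n + n * n ≡ 2 * (n * n)
            double = solve-∀
            distrib : ∀ k m n → 2 * (k * (m + n)) ≡ 2 * (k * m) + 2 * k * n
            distrib = solve-∀
            reorder : ∀ k m n → k + m + n ≡ k + n + m
            reorder = solve-∀
            R²≤ : R * R ≤ M * (R + pairs p)
            R²≤ = begin
              R * R                                      ≤⟨ ℕₚ.*-mono-≤ richness≤∑piece richness≤∑piece ⟩
              ∑ (upTo M) piece * ∑ (upTo M) piece        ≤⟨ ∑-cauchySchwarz (upTo M) piece ⟩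
              length (upTo M) * (∑[ i ← upTo M ] (piece i * piece i))
                ≡⟨ ≡.cong (_* (∑[ i ← upTo M ] (piece i * piece i))) (length-upTo M) ⟩
              M * (∑[ i ← upTo M ] (piece i * piece i))  ≤⟨ ℕₚ.*-monoʳ-≤ M ∑piece² ⟩
              M * (R + pairs p)                          ∎

      ∑-richness² : (∑[ p ← xs ] (richness p * richness p)) ≤
                    length xs * (M * M) + 2 * M * close-pairs
      ∑-richness² = begin
        (∑[ p ← xs ] (richness p * richness p))
          ≤⟨ ∑-mono-All (All.map richness² good) ⟩
        (∑[ p ← xs ] (M * M + 2 * M * pairs p))
          ≡⟨ ∑-+ xs _ _ ⟩
        (∑[ _ ← xs ] (M * M)) + (∑[ p ← xs ] (2 * M * pairs p))
          ≡⟨ ≡.cong₂ _+_ (∑-const xs (M * M)) (∑-*ˡ (2 * M) xs pairs) ⟩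
        length xs * (M * M) + 2 * M * ∑ xs pairs
          ≤⟨ ℕₚ.+-monoʳ-≤ (length xs * (M * M)) (ℕₚ.*-monoʳ-≤ (2 * M) ∑-pairs) ⟩
        length xs * (M * M) + 2 * M * close-pairs ∎

-- A ring solver with integer coefficients.

module IntegerCoefficients {c ℓ} (R : CommutativeRing c ℓ) where
  open CommutativeRing R
  open RingProperties ring using (-‿involutive; -‿distribˡ-*; -‿distribʳ-*; -0#≈0#)
  open AbelianGroupProperties +-abelianGroup using (⁻¹-∙-comm)
  open Mult semiring using (×-homo-+; ×1-homo-*) renaming (_×_ to _×ᵐ_)
  open SetoidReasoning setoid

  fromℤ : ℤ → Carrier
  fromℤ (+ n)    = n ×ᵐ 1#
  fromℤ -[1+ n ] = - (suc n ×ᵐ 1#)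

  -- Agrees with fromℤ, but sends 1 to 1# itself rather than to 1# + 0#, so that
  -- both 1# and the numerals n × 1# (n ≥ 2) are literally solver constants.
  ⟦_⟧ : ℤ → Carrier
  ⟦ + suc zero ⟧ = 1#
  ⟦ i ⟧          = fromℤ i

  private
    fromℤ-neg : ∀ i → fromℤ (ℤ.- i) ≈ - fromℤ i
    fromℤ-neg (+ zero)  = sym -0#≈0#
    fromℤ-neg (+ suc n) = refl
    fromℤ-neg -[1+ n ]  = sym (-‿involutive _)

    x-0≈x : ∀ x → x - 0# ≈ x
    x-0≈x x = trans (+-congˡ -0#≈0#) (+-identityʳ x)

    fromℤ-⊖ : ∀ m n → fromℤ (m ⊖ n) ≈ m ×ᵐ 1# - n ×ᵐ 1#
    fromℤ-⊖ zero    zero    = sym (x-0≈x 0#)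
    fromℤ-⊖ (suc m) zero    = sym (x-0≈x _)
    fromℤ-⊖ zero    (suc n) = sym (+-identityˡ _)
    fromℤ-⊖ (suc m) (suc n) = begin
      fromℤ (suc m ⊖ suc n)                     ≡⟨ ≡.cong fromℤ (ℤₚ.[1+m]⊖[1+n]≡m⊖n m n) ⟩
      fromℤ (m ⊖ n)                             ≈⟨ fromℤ-⊖ m n ⟩
      -- `1# - 1#` is inserted; `1#` then joins `a` and `- 1#` joins `- b`, which produces both
      -- successors.
      a - b                                     ≈⟨ +-congʳ (+-identityʳ a) ⟨
      a + 0# - b                                ≈⟨ +-congʳ (+-congˡ (-‿inverseʳ 1#)) ⟨
      a + (1# - 1#) - b                         ≈⟨ +-congʳ (+-assoc _ _ _) ⟨
      a + 1# - 1# - b                           ≈⟨ +-assoc _ _ _ ⟩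
      a + 1# + (- 1# - b)                       ≈⟨ +-cong (+-comm _ _) (⁻¹-∙-comm _ _) ⟩
      1# + a - (1# + b)                         ∎
      where
      a b : Carrier
      a = m ×ᵐ 1#
      b = n ×ᵐ 1#

    fromℤ-+ : ∀ i j → fromℤ (i ℤ.+ j) ≈ fromℤ i + fromℤ j
    fromℤ-+ (+ m)    (+ n)    = ×-homo-+ 1# m n
    fromℤ-+ (+ m)    -[1+ n ] = fromℤ-⊖ m (suc n)
    fromℤ-+ -[1+ m ] (+ n)    = trans (fromℤ-⊖ n (suc m)) (+-comm _ _)
    fromℤ-+ -[1+ m ] -[1+ n ] = begin
      - (suc (suc (m ℕ.+ n)) ×ᵐ 1#)       ≡⟨ ≡.cong (λ k → - (suc k ×ᵐ 1#)) (ℕₚ.+-suc m n) ⟨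
      - ((suc m ℕ.+ suc n) ×ᵐ 1#)         ≈⟨ -‿cong (×-homo-+ 1# (suc m) (suc n)) ⟩
      - (suc m ×ᵐ 1# + suc n ×ᵐ 1#)       ≈⟨ ⁻¹-∙-comm _ _ ⟨
      - (suc m ×ᵐ 1#) - suc n ×ᵐ 1#       ∎

    fromℤ-◃⁺ : ∀ n → fromℤ (Sign.+ ℤ.◃ n) ≈ n ×ᵐ 1#
    fromℤ-◃⁺ zero    = refl
    fromℤ-◃⁺ (suc n) = refl

    fromℤ-◃⁻ : ∀ n → fromℤ (Sign.- ℤ.◃ n) ≈ - (n ×ᵐ 1#)
    fromℤ-◃⁻ zero    = sym -0#≈0#
    fromℤ-◃⁻ (suc n) = refl

    fromℤ-* : ∀ i j → fromℤ (i ℤ.* j) ≈ fromℤ i * fromℤ j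
    fromℤ-* (+ m)    (+ n)    = trans (fromℤ-◃⁺ (m ℕ.* n)) (×1-homo-* m n)
    fromℤ-* (+ m)    -[1+ n ] = begin
      fromℤ (Sign.- ℤ.◃ (m ℕ.* suc n))    ≈⟨ fromℤ-◃⁻ (m ℕ.* suc n) ⟩
      - ((m ℕ.* suc n) ×ᵐ 1#)             ≈⟨ -‿cong (×1-homo-* m (suc n)) ⟩
      - (m ×ᵐ 1# * suc n ×ᵐ 1#)           ≈⟨ -‿distribʳ-* _ _ ⟩
      m ×ᵐ 1# * - (suc n ×ᵐ 1#)           ∎
    fromℤ-* -[1+ m ] (+ n)    = begin
      fromℤ (Sign.- ℤ.◃ (suc m ℕ.* n))    ≈⟨ fromℤ-◃⁻ (suc m ℕ.* n) ⟩
      - ((suc m ℕ.* n) ×ᵐ 1#)             ≈⟨ -‿cong (×1-homo-* (suc m) n) ⟩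
      - (suc m ×ᵐ 1# * n ×ᵐ 1#)           ≈⟨ -‿distribˡ-* _ _ ⟩
      - (suc m ×ᵐ 1#) * n ×ᵐ 1#           ∎
    fromℤ-* -[1+ m ] -[1+ n ] = begin
      (suc m ℕ.* suc n) ×ᵐ 1#             ≈⟨ ×1-homo-* (suc m) (suc n) ⟩
      suc m ×ᵐ 1# * suc n ×ᵐ 1#           ≈⟨ -‿involutive _ ⟨
      - - (suc m ×ᵐ 1# * suc n ×ᵐ 1#)     ≈⟨ -‿cong (-‿distribʳ-* _ _) ⟩
      - (suc m ×ᵐ 1# * - (suc n ×ᵐ 1#))   ≈⟨ -‿distribˡ-* _ _ ⟩
      - (suc m ×ᵐ 1#) * - (suc n ×ᵐ 1#)   ∎

    ⟦_⟧≈fromℤ : ∀ i → ⟦ i ⟧ ≈ fromℤ i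
    ⟦ + zero ⟧≈fromℤ        = refl
    ⟦ + suc zero ⟧≈fromℤ    = sym (+-identityʳ 1#)
    ⟦ + suc (suc n) ⟧≈fromℤ = refl
    ⟦ -[1+ n ] ⟧≈fromℤ      = refl

    ⟦⟧-homo : ℤ.+-*-rawRing -Raw-AlmostCommutative⟶ fromCommutativeRing R
    ⟦⟧-homo = record
      { ⟦_⟧    = ⟦_⟧
      ; +-homo = λ i j → via (i ℤ.+ j) (fromℤ-+ i j) (+-cong ⟦ i ⟧≈fromℤ ⟦ j ⟧≈fromℤ)
      ; *-homo = λ i j → via (i ℤ.* j) (fromℤ-* i j) (*-cong ⟦ i ⟧≈fromℤ ⟦ j ⟧≈fromℤ)
      ; -‿homo = λ i → via (ℤ.- i) (fromℤ-neg i) (-‿cong ⟦ i ⟧≈fromℤ)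
      ; 0-homo = refl
      ; 1-homo = refl
      }
      where
      via : ∀ i {x y} → fromℤ i ≈ y → x ≈ y → ⟦ i ⟧ ≈ x
      via i i≈y x≈y = trans ⟦ i ⟧≈fromℤ (trans i≈y (sym x≈y))

    -- Only equality of the integers themselves is recognised; unequal integers give `nothing`, with
    -- no claim about their images.
    coeff≟ : ∀ i j → Maybe (⟦ i ⟧ ≈ ⟦ j ⟧)
    coeff≟ i j = Maybe.map (λ { ≡.refl → refl }) (dec⇒maybe (i ℤₚ.≟ j))

  open RingSolver ℤ.+-*-rawRing (fromCommutativeRing R) ⟦⟧-homo coeff≟ public
    using (solve; con; _:+_; _:*_; _:-_; :-_; _:=_)

-- Inequalities in an ordered field.

module OrderedField (F : CompleteOrderedField) where
  open CompleteOrderedField F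
  open IntegerCoefficients commutativeRing public
  open IsDecTotalOrder isDecTotalOrder public
    using (total)
    renaming (refl to ≤-refl; trans to ≤-trans; antisym to ≤-antisym; reflexive to ≤-reflexive;
              ≤-respˡ-≈ to ≤-respˡ; ≤-respʳ-≈ to ≤-respʳ)
  open Mult semiring using () renaming (_×_ to _×ᵐ_)
  open RingProperties ring using (x∙y⁻¹≈ε⇒x≈y)

  -- Inequalities are proved by certificates: `d` is visibly non-negative, and the identity is left
  -- to the ring solver.
  ≤-by : ∀ {x y d} → 0# ≤ d → y ≈ x + d → x ≤ y
  ≤-by {x} {y} {d} 0≤d y≈x+d =
    ≤-respˡ (+-identityˡ x) (≤-respʳ (trans (+-comm d x) (sym y≈x+d)) (+-monoˡ-≤ x 0≤d))

  x≤y⇒0≤y-x : ∀ {x y} → x ≤ y → 0# ≤ y - x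
  x≤y⇒0≤y-x {x} x≤y = ≤-respˡ (-‿inverseʳ x) (+-monoˡ-≤ (- x) x≤y)

  +-nonNeg : ∀ {x y} → 0# ≤ x → 0# ≤ y → 0# ≤ x + y
  +-nonNeg {x} {y} 0≤x 0≤y = ≤-trans 0≤y (≤-by 0≤x (+-comm x y))

  +-mono-≤ : ∀ {w x y z} → w ≤ x → y ≤ z → w + y ≤ x + z
  +-mono-≤ {w} {x} {y} {z} w≤x y≤z = ≤-by (+-nonNeg (x≤y⇒0≤y-x w≤x) (x≤y⇒0≤y-x y≤z))
    (solve 4 (λ w x y z → x :+ z := w :+ y :+ (x :- w :+ (z :- y))) refl w x y z)

  *-monoˡ-≤ : ∀ {x y z} → 0# ≤ z → x ≤ y → z * x ≤ z * y
  *-monoˡ-≤ {x} {y} {z} 0≤z x≤y = ≤-by (*-nonNeg 0≤z (x≤y⇒0≤y-x x≤y))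
    (solve 3 (λ x y z → z :* y := z :* x :+ z :* (y :- x)) refl x y z)

  *-monoʳ-≤ : ∀ {x y z} → 0# ≤ z → x ≤ y → x * z ≤ y * z
  *-monoʳ-≤ {x} {y} {z} 0≤z x≤y =
    ≤-respˡ (*-comm z x) (≤-respʳ (*-comm z y) (*-monoˡ-≤ 0≤z x≤y))

  x≈y⇒x-y≈0 : ∀ {x y} → x ≈ y → x - y ≈ 0#
  x≈y⇒x-y≈0 {y = y} x≈y = trans (+-congʳ x≈y) (-‿inverseʳ y)

  x-y≈0⇒x≈y : ∀ {x y} → x - y ≈ 0# → x ≈ y
  x-y≈0⇒x≈y = x∙y⁻¹≈ε⇒x≈y _ _

  0≤x² : ∀ x → 0# ≤ x * x
  0≤x² x with total 0# x
  ... | inj₁ 0≤x = *-nonNeg 0≤x 0≤x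
  ... | inj₂ x≤0 = ≤-respʳ (solve 1 (λ x → (con (+ 0) :- x) :* (con (+ 0) :- x) := x :* x) refl x)
                     (*-nonNeg (x≤y⇒0≤y-x x≤0) (x≤y⇒0≤y-x x≤0))

  0≤1 : 0# ≤ 1#
  0≤1 = ≤-respʳ (*-identityˡ 1#) (0≤x² 1#)

  fromℕ-nonNeg : ∀ n → 0# ≤ n ×ᵐ 1#
  fromℕ-nonNeg zero    = ≤-refl
  fromℕ-nonNeg (suc n) = +-nonNeg 0≤1 (fromℕ-nonNeg n)

  fromℕ-mono : ∀ {m n} → m ℕ.≤ n → m ×ᵐ 1# ≤ n ×ᵐ 1#
  fromℕ-mono {n = n} ℕ.z≤n = fromℕ-nonNeg n
  fromℕ-mono (ℕ.s≤s m≤n)   = +-mono-≤ ≤-refl (fromℕ-mono m≤n)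

  fromℕ-pos : ∀ {n} → 1 ℕ.≤ n → 0# < n ×ᵐ 1#
  fromℕ-pos {n} 1≤n = fromℕ-nonNeg n , λ 0≈n → 0≉1 (≤-antisym 0≤1
    (≤-respˡ (+-identityʳ 1#) (≤-respʳ (sym 0≈n) (fromℕ-mono 1≤n))))

  ≰⇒≥ : ∀ {x y} → ¬ x ≤ y → y ≤ x
  ≰⇒≥ {x} {y} x≰y with total x y
  ... | inj₁ x≤y = contradiction x≤y x≰y
  ... | inj₂ y≤x = y≤x

  x*y≈0⇒y≈0 : ∀ {x y} → x ≉ 0# → x * y ≈ 0# → y ≈ 0#
  x*y≈0⇒y≈0 {x} {y} x≉0 xy≈0 = begin
    y               ≈⟨ *-identityˡ y ⟨
    1# * y          ≈⟨ *-congʳ (⁻¹-inverseʳ x x≉0) ⟨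
    x * x ⁻¹ * y    ≈⟨ solve 3 (λ x x⁻¹ y → x :* x⁻¹ :* y := x⁻¹ :* (x :* y)) refl x (x ⁻¹) y ⟩
    x ⁻¹ * (x * y)  ≈⟨ *-congˡ xy≈0 ⟩
    x ⁻¹ * 0#       ≈⟨ zeroʳ _ ⟩
    0#              ∎
    where open SetoidReasoning setoid

  -- If `y ≤ x`, then `z * x` and `z * y` are equal by antisymmetry, so `z * (x - y)` vanishes and
  -- `x ≈ y`.
  *-cancelˡ-≤ : ∀ {x y z} → 0# < z → z * x ≤ z * y → x ≤ y
  *-cancelˡ-≤ {x} {y} {z} (0≤z , 0≉z) zx≤zy with total x y
  ... | inj₁ x≤y = x≤y
  ... | inj₂ y≤x = ≤-reflexive (x-y≈0⇒x≈y (x*y≈0⇒y≈0 (λ z≈0 → 0≉z (sym z≈0))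
      (trans (solve 3 (λ x y z → z :* (x :- y) := z :* x :- z :* y) refl x y z)
             (x≈y⇒x-y≈0 (≤-antisym zx≤zy (*-monoˡ-≤ 0≤z y≤x))))))

  0<x⇒x≉0 : ∀ {x} → 0# < x → x ≉ 0#
  0<x⇒x≉0 (_ , 0≉x) x≈0 = 0≉x (sym x≈0)

  ⁻¹-nonNeg : ∀ {x} → 0# < x → 0# ≤ x ⁻¹
  ⁻¹-nonNeg {x} 0<x = *-cancelˡ-≤ 0<x
    (≤-respˡ (sym (zeroʳ x)) (≤-respʳ (sym (⁻¹-inverseʳ x (0<x⇒x≉0 0<x))) 0≤1))

  <-≤-trans : ∀ {x y z} → x < y → y ≤ z → x < z
  <-≤-trans (x≤y , x≉y) y≤z =
    ≤-trans x≤y y≤z , λ x≈z → x≉y (≤-antisym x≤y (≤-respʳ (sym x≈z) y≤z))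

  -- A certificate modulo the relation `u ≈ v`: the multiple `q * (u - v)` is zero, but lets the
  -- solver use relations such as `s * t ≈ 1#` that are not ring identities.
  ≤-by-mod : ∀ {x y d u v} q → 0# ≤ d → u ≈ v → y ≈ x + d + q * (u - v) → x ≤ y
  ≤-by-mod {x} {y} {d} q 0≤d u≈v y≈ = ≤-by 0≤d
    (trans y≈ (trans (+-congˡ (trans (*-congˡ (x≈y⇒x-y≈0 u≈v)) (zeroʳ q))) (+-identityʳ _)))

  ≤-by-mod₂ : ∀ {x y d u v u′ v′} q q′ → 0# ≤ d → u ≈ v → u′ ≈ v′ →
              y ≈ x + d + q * (u - v) + q′ * (u′ - v′) → x ≤ y
  ≤-by-mod₂ q q′ 0≤d u≈v u′≈v′ y≈ = ≤-by-mod q 0≤d u≈v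
    (trans y≈ (trans (+-congˡ (trans (*-congˡ (x≈y⇒x-y≈0 u′≈v′)) (zeroʳ q′))) (+-identityʳ _)))

-- Exponential and logarithm.

module ExpLog (reals : Reals) where
  open Reals reals
  open RealGeometry reals using (fromℕ)
  open OrderedField completeOrderedField public

  ½ : ℝ
  ½ = fromℕ 2 ⁻¹

  2*½≈1 : fromℕ 2 * ½ ≈ 1#
  2*½≈1 = ⁻¹-inverseʳ _ (0<x⇒x≉0 (fromℕ-pos {2} (ℕ.s≤s ℕ.z≤n)))

  -- The value is the square of the exponential of x/2.
  exp-nonNeg : ∀ x → 0# ≤ exp x
  exp-nonNeg x = ≤-respʳ (trans (sym (exp-+ _ _)) (exp-cong halves)) (0≤x² (exp (½ * x)))
    where
    halves : ½ * x + ½ * x ≈ x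
    halves = begin
      ½ * x + ½ * x     ≈⟨ solve 2 (λ h x → h :* x :+ h :* x := con (+ 2) :* h :* x) refl ½ x ⟩
      fromℕ 2 * ½ * x   ≈⟨ *-congʳ 2*½≈1 ⟩
      1# * x            ≈⟨ *-identityˡ x ⟩
      x                 ∎
      where open SetoidReasoning setoid

  exp-split : ∀ x y → exp y ≈ exp x * exp (y - x)
  exp-split x y = trans (exp-cong (solve 2 (λ x y → y := x :+ (y :- x)) refl x y)) (exp-+ x (y - x))

  -- The graph lies above its tangent at `x`: this is `1+x≤exp` at `y - x`, scaled by `exp x`.
  exp-grows : ∀ x y → exp x + exp x * (y - x) ≤ exp y
  exp-grows x y = ≤-respʳ (sym (exp-split x y))
    (≤-respˡ (trans (distribˡ _ _ _) (+-congʳ (*-identityʳ _)))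
      (*-monoˡ-≤ (exp-nonNeg x) (1+x≤exp (y - x))))

  exp-mono : ∀ {x y} → x ≤ y → exp x ≤ exp y
  exp-mono {x} {y} x≤y = ≤-trans (≤-by (*-nonNeg (exp-nonNeg x) (x≤y⇒0≤y-x x≤y)) refl) (exp-grows x y)

  0<exp0 : 0# < exp 0#
  0<exp0 = <-≤-trans (0≤1 , 0≉1) (≤-respˡ (+-identityʳ 1#) (1+x≤exp 0#))

  exp-pos : ∀ x → 0# < exp x
  exp-pos x = exp-nonNeg x , λ 0≈expx → proj₂ 0<exp0 (begin
    0#                     ≈⟨ zeroˡ _ ⟨
    0# * exp (0# - x)      ≈⟨ *-congʳ 0≈expx ⟩
    exp x * exp (0# - x)   ≈⟨ exp-split x 0# ⟨
    exp 0#                 ∎)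
    where open SetoidReasoning setoid

  -- The tangent at `y`, evaluated at `x`, gives `exp y * (x - y) ≤ 0#`, and `exp y` is positive.
  exp-cancel-≤ : ∀ {x y} → exp x ≤ exp y → x ≤ y
  exp-cancel-≤ {x} {y} expx≤expy = ≤-by (x≤y⇒0≤y-x (*-cancelˡ-≤ (exp-pos y) product≤0))
    (solve 2 (λ x y → y := x :+ (con (+ 0) :- (x :- y))) refl x y)
    where
    product≤0 : exp y * (x - y) ≤ exp y * 0#
    product≤0 = ≤-by (x≤y⇒0≤y-x (≤-trans (exp-grows y x) expx≤expy))
      (solve 2 (λ e z → e :* con (+ 0) := e :* z :+ (e :- (e :+ e :* z))) refl (exp y) (x - y))

  exp-0 : exp 0# ≈ 1#
  exp-0 = x-y≈0⇒x≈y (x*y≈0⇒y≈0 (0<x⇒x≉0 0<exp0) (begin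
    e * (e - 1#)   ≈⟨ solve 1 (λ e → e :* (e :- con (+ 1)) := e :* e :- e) refl e ⟩
    e * e - e      ≈⟨ x≈y⇒x-y≈0 (trans (sym (exp-+ 0# 0#)) (exp-cong (+-identityˡ 0#))) ⟩
    0#             ∎))
    where
    open SetoidReasoning setoid
    e : ℝ
    e = exp 0#

  log-exp : ∀ x → log (exp x) ≈ x
  log-exp x = ≤-antisym (exp-cancel-≤ (≤-reflexive e)) (exp-cancel-≤ (≤-reflexive (sym e)))
    where
    e : exp (log (exp x)) ≈ exp x
    e = exp-log (exp-pos x)

  exp-fromℕ : ∀ {n} → 1 ℕ.≤ n → exp (log (fromℕ n)) ≈ fromℕ n
  exp-fromℕ 1≤n = exp-log (fromℕ-pos 1≤n)

  -- By `1+x≤exp` at -L, 2 (1 - L) ≤ n exp (-L) = 1. This lower bound brings the factor log n into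
  -- the final estimate.
  1≤2*log : ∀ {n} → 2 ℕ.≤ n → 1# ≤ fromℕ 2 * log (fromℕ n)
  1≤2*log {n} 2≤n = ≤-by (x≤y⇒0≤y-x 2*[1-L]≤1)
    (solve 1 (λ L → con (+ 2) :* L
       := con (+ 1) :+ (con (+ 1) :- con (+ 2) :* (con (+ 1) :+ (con (+ 0) :- L)))) refl L)
    where
    L : ℝ
    L = log (fromℕ n)
    n*exp≈1 : fromℕ n * exp (0# - L) ≈ 1#
    n*exp≈1 = begin
      fromℕ n * exp (0# - L)  ≈⟨ *-congʳ (exp-fromℕ (ℕₚ.≤-trans (ℕ.s≤s ℕ.z≤n) 2≤n)) ⟨
      exp L * exp (0# - L)    ≈⟨ exp-split L 0# ⟨
      exp 0#                  ≈⟨ exp-0 ⟩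
      1#                      ∎
      where open SetoidReasoning setoid
    2*[1-L]≤1 : fromℕ 2 * (1# + (0# - L)) ≤ 1#
    2*[1-L]≤1 = ≤-respʳ n*exp≈1 (≤-trans
      (*-monoˡ-≤ (fromℕ-nonNeg 2) (1+x≤exp (0# - L)))
      (*-monoʳ-≤ (exp-nonNeg _) (fromℕ-mono 2≤n)))

  0≤log : ∀ {n} → 1 ℕ.≤ n → 0# ≤ log (fromℕ n)
  0≤log 1≤n = exp-cancel-≤ (≤-respˡ (sym exp-0) (≤-respʳ (sym (exp-fromℕ 1≤n))
    (≤-respˡ (+-identityʳ 1#) (fromℕ-mono 1≤n))))

  0≤log2 : 0# ≤ log (fromℕ 2)
  0≤log2 = 0≤log {2} (ℕ.s≤s ℕ.z≤n)

-- Integer cube roots and binomial coefficients.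

cube : ℕ → ℕ
cube m = m ℕ.* m ℕ.* m

cube-mono : ∀ {m n} → m ℕ.≤ n → cube m ℕ.≤ cube n
cube-mono m≤n = ℕₚ.*-mono-≤ (ℕₚ.*-mono-≤ m≤n m≤n) m≤n

cube-mono-< : ∀ {m n} → m ℕ.< n → cube m ℕ.< cube n
cube-mono-< {m} {n} m<n =
  ℕₚ.*-mono-< {m ℕ.* m} {n ℕ.* n} (ℕₚ.*-mono-< {m} {n} m<n m<n) m<n

-- When `n` grows by one, the root either stays or grows by one.
cubeRoot : ∀ n → 1 ℕ.≤ n → ∃[ m ] (1 ℕ.≤ m × cube m ℕ.≤ n × n ℕ.< cube (suc m))
cubeRoot 1             _ = 1 , ℕₚ.≤-refl , ℕₚ.≤-refl , ℕ.s≤s (ℕ.s≤s ℕ.z≤n)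
cubeRoot (suc (suc n)) _ with m , 1≤m , m³≤ , <[1+m]³ ← cubeRoot (suc n) (ℕ.s≤s ℕ.z≤n)
                            | cube (suc m) ℕₚ.≤? suc (suc n)
... | yes [1+m]³≤ = suc m , ℕ.s≤s ℕ.z≤n , [1+m]³≤ ,
  -- `suc n < cube (suc m)` is by definition `suc (suc n) ≤ cube (suc m)`.
  ℕₚ.≤-<-trans <[1+m]³ (cube-mono-< (ℕₚ.n<1+n (suc m)))
... | no [1+m]³≰  = m , 1≤m , ℕₚ.≤-trans m³≤ (ℕₚ.n≤1+n _) , ℕₚ.≰⇒> [1+m]³≰

nC2-suc : ∀ n → suc n C 2 ≡ n ℕ.+ n C 2
nC2-suc n = ≡.trans (≡.sym (nCk+nC[k+1]≡[n+1]C[k+1] n 1)) (≡.cong (ℕ._+ n C 2) (nC1≡n n))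

nC2≤n² : ∀ n → n C 2 ℕ.≤ n ℕ.* n
nC2≤n² zero    = ℕ.z≤n
nC2≤n² (suc n) rewrite nC2-suc n = ℕₚ.+-mono-≤ (ℕₚ.n≤1+n n)
  (ℕₚ.≤-trans (nC2≤n² n) (ℕₚ.*-monoʳ-≤ n (ℕₚ.n≤1+n n)))

nC2>0 : ∀ {n} → 2 ℕ.≤ n → 1 ℕ.≤ n C 2
nC2>0 {suc n} (ℕ.s≤s 1≤n) rewrite nC2-suc n = ℕₚ.≤-trans 1≤n (ℕₚ.m≤m+n n _)

-- Comparison of exponents.

module Exponents (F : CompleteOrderedField) where
  open CompleteOrderedField F
  open OrderedField F
  open RawMonoid +-rawMonoid using () renaming (_×_ to _×ᵐ_)

  -- Here `h` is ½ and `m`, `ℓ`, `λ′` are the logarithms of M, of 2 and of the squared distance. The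
  -- hypothesis gives -s λ′/2 ≥ s m - s ℓ/2, and s/2 ≤ 1. The factor `1#` matches the exponent in
  -- `√_`.
  distance-exponent : ∀ {s h ℓ m λ′} → (2 ×ᵐ 1#) * h ≈ 1# → 0# ≤ h → 0# ≤ ℓ →
                      0# ≤ s → 0# ≤ 2 ×ᵐ 1# - s → m + m + λ′ ≤ ℓ →
                      s * m - ℓ ≤ - s * (1# * h * λ′)
  distance-exponent {s} {h} {ℓ} {m} {λ′} 2*h≈1 0≤h 0≤ℓ 0≤s 0≤2-s bound = ≤-by-mod (s * m - ℓ)
    (+-nonNeg (*-nonNeg (*-nonNeg 0≤s 0≤h) (x≤y⇒0≤y-x bound)) (*-nonNeg (*-nonNeg 0≤ℓ 0≤h) 0≤2-s))
    2*h≈1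
    (solve 5 (λ s h ℓ m λ′ →
      :- s :* (con (+ 1) :* h :* λ′) :=
      s :* m :- ℓ :+ (s :* h :* (ℓ :- (m :+ m :+ λ′)) :+ ℓ :* h :* (con (+ 2) :- s))
        :+ (s :* m :- ℓ) :* (con (+ 2) :* h :- con (+ 1)))
      refl s h ℓ m λ′)

  -- In the application L, m and ℓ are the logarithms of n, of M ≈ n ^ (1 / 3) and of 2.
  module _ {s t j : Carrier} (s*t≈1 : s * t ≈ 1#) (3*j≈1 : (3 ×ᵐ 1#) * j ≈ 1#)
           (0≤t : 0# ≤ t) (0≤j : 0# ≤ j) (0≤s-1 : 0# ≤ s - 1#) (0≤2-s : 0# ≤ 2 ×ᵐ 1# - s) where

    -- As m ≤ L/3, the left side is at most 5L/3. The remaining coefficient is t - 1/3 = j (3 t - s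
    -- t) = j (t + t (2 - s)), which is non-negative.
    poor-exponent : ∀ {L m} → 0# ≤ L → m + m + m ≤ L → L + (m + m) ≤ ((4 ×ᵐ 1#) * j + t) * L
    poor-exponent {L} {m} 0≤L 3m≤L = ≤-by-mod₂ (j * L) (L - t * L + (m + m))
      (+-nonNeg (*-nonNeg (*-nonNeg 0≤j (+-nonNeg 0≤t (*-nonNeg 0≤t 0≤2-s))) 0≤L)
                (*-nonNeg (*-nonNeg (fromℕ-nonNeg 2) 0≤j) (x≤y⇒0≤y-x 3m≤L)))
      s*t≈1 3*j≈1
      (solve 5 (λ s t j L m →
        (con (+ 4) :* j :+ t) :* L :=
        L :+ (m :+ m)
          :+ (j :* (t :+ t :* (con (+ 2) :- s)) :* L :+ con (+ 2) :* j :* (L :- (m :+ m :+ m)))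
          :+ j :* L :* (s :* t :- con (+ 1))
          :+ (L :- t :* L :+ (m :+ m)) :* (con (+ 3) :* j :- con (+ 1)))
        refl s t j L m)

    -- The coefficient of L is non-negative: s + 3 t − 3 = t ((s − 1)² + (2 − s)).
    energy-exponent : ∀ {L m ℓ} → 0# ≤ L → 0# ≤ ℓ → L ≤ (3 ×ᵐ 1#) * (m + ℓ) →
                      L + L + (m - (s * m - ℓ)) ≤ ((4 ×ᵐ 1#) * j + t) * L + (ℓ + ℓ)
    energy-exponent {L} {m} {ℓ} 0≤L 0≤ℓ L≤ =
      ≤-by-mod₂ (j * (3 ×ᵐ 1# - s) * L) ((2 ×ᵐ 1# - t) * L - (s - 1#) * (m + ℓ))
      (+-nonNeg (+-nonNeg
        (*-nonNeg (*-nonNeg 0≤j (*-nonNeg 0≤t (+-nonNeg (0≤x² (s - 1#)) 0≤2-s))) 0≤L)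
        (*-nonNeg 0≤2-s 0≤ℓ))
        (*-nonNeg (*-nonNeg 0≤s-1 0≤j) (x≤y⇒0≤y-x L≤)))
      s*t≈1 3*j≈1
      (solve 6 (λ s t j L m ℓ →
        (con (+ 4) :* j :+ t) :* L :+ (ℓ :+ ℓ) :=
        L :+ L :+ (m :- (s :* m :- ℓ))
          :+ (j :* (t :* ((s :- con (+ 1)) :* (s :- con (+ 1)) :+ (con (+ 2) :- s))) :* L
              :+ (con (+ 2) :- s) :* ℓ
              :+ (s :- con (+ 1)) :* j :* (con (+ 3) :* (m :+ ℓ) :- L))
          :+ j :* (con (+ 3) :- s) :* L :* (s :* t :- con (+ 1))
          :+ ((con (+ 2) :- t) :* L :- (s :- con (+ 1)) :* (m :+ ℓ)) :* (con (+ 3) :* j :- con (+ 1)))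
        refl s t j L m ℓ)

-- Lines, strips and close pairs in the unit square.

module Geometry (reals : Reals) where
  open Reals reals hiding (zero)
  open RealGeometry reals
  open ExpLog reals
  open Exponents completeOrderedField
  open DecSetoid pointDecSetoid using () renaming (_≈_ to _≈ₚ_)

  -- For non-negative `y` and positive `M`, the integer part of `y` capped at M - 1; the cap puts
  -- the end point `y = M` into the last cell.
  cell : ℕ → ℝ → ℕ
  cell zero    y = zero
  cell (suc m) y with fromℕ m ≤? y
  ... | yes _ = m
  ... | no _  = cell m y

  cell<M : ∀ M {y} → 1 ℕ.≤ M → cell M y ℕ.< M
  cell<M (suc m) {y} _ with fromℕ m ≤? y
  ... | yes _ = ℕₚ.≤-refl
  ... | no _ with m
  ...   | zero  = ℕₚ.≤-refl
  ...   | suc k = ℕₚ.m≤n⇒m≤1+n (cell<M (suc k) (ℕ.s≤s ℕ.z≤n))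

  cell≤ : ∀ M {y} → 0# ≤ y → fromℕ (cell M y) ≤ y
  cell≤ zero    0≤y = 0≤y
  cell≤ (suc m) {y} 0≤y with fromℕ m ≤? y
  ... | yes m≤y = m≤y
  ... | no _    = cell≤ m 0≤y

  ≤1+cell : ∀ M {y} → y ≤ fromℕ M → y ≤ 1# + fromℕ (cell M y)
  ≤1+cell zero    y≤0 = ≤-trans y≤0 (fromℕ-nonNeg 1)
  ≤1+cell (suc m) {y} y≤ with fromℕ m ≤? y
  ... | yes _  = y≤
  ... | no m≰y = ≤1+cell m (≰⇒≥ m≰y)

  -- Both numbers lie in [c, c + 1]. The certificate factors 1 - (y - z)² as (1 - y + z) (1 - z +
  -- y), and splits each factor at `c`.
  same-cell : ∀ M {y z} → 0# ≤ y → y ≤ fromℕ M → 0# ≤ z → z ≤ fromℕ M →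
              cell M y ≡ cell M z → (y - z) * (y - z) ≤ 1#
  same-cell M {y} {z} 0≤y y≤M 0≤z z≤M same = ≤-by
    (*-nonNeg (+-nonNeg (x≤y⇒0≤y-x (≤1+cell M y≤M)) (x≤y⇒0≤y-x c≤z))
              (+-nonNeg (x≤y⇒0≤y-x z≤1+c) (x≤y⇒0≤y-x (cell≤ M 0≤y))))
    (solve 3 (λ c y z → con (+ 1) := (y :- z) :* (y :- z)
        :+ (con (+ 1) :+ c :- y :+ (z :- c)) :* (con (+ 1) :+ c :- z :+ (y :- c)))
      refl (fromℕ (cell M y)) y z)
    where
    c≤z : fromℕ (cell M y) ≤ z
    c≤z = ≡.subst (λ k → fromℕ k ≤ z) (≡.sym same) (cell≤ M 0≤z)
    z≤1+c : z ≤ 1# + fromℕ (cell M y)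
    z≤1+c = ≡.subst (λ k → z ≤ 1# + fromℕ k) (≡.sym same) (≤1+cell M z≤M)

  -- From b v = -a u it follows that b² v² = a² u² ≤ b² u², and b² cancels. Here (u, v) is a
  -- direction of the line with normal (a, b).
  orthogonal-≤ : ∀ {a b u v} → 0# ≤ a → a ≤ b → 0# < b → a * u + b * v ≈ 0# → v * v ≤ u * u
  orthogonal-≤ {a} {b} {u} {v} 0≤a a≤b 0<b au+bv≈0 =
    *-cancelˡ-≤ 0<b² (≤-by-mod (b * v - a * u)
      (*-nonNeg (0≤x² u) (*-nonNeg (x≤y⇒0≤y-x a≤b) (+-nonNeg 0≤a (proj₁ 0<b)))) (sym au+bv≈0)
      (solve 4 (λ a b u v → b :* b :* (u :* u) :=
        b :* b :* (v :* v) :+ u :* u :* ((b :- a) :* (a :+ b))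
          :+ (b :* v :- a :* u) :* (con (+ 0) :- (a :* u :+ b :* v))) refl a b u v))
    where
    0<b² : 0# < b * b
    0<b² = *-nonNeg (proj₁ 0<b) (proj₁ 0<b) ,
      λ 0≈b² → proj₂ 0<b (sym (x*y≈0⇒y≈0 (0<x⇒x≉0 0<b) (sym 0≈b²)))

  orthogonal : ∀ {α a b q₁ q₂ r₁ r₂} → a * q₁ + b * q₂ ≈ α → a * r₁ + b * r₂ ≈ α →
               a * (q₁ - r₁) + b * (q₂ - r₂) ≈ 0#
  orthogonal {α} {a} {b} {q₁} {q₂} {r₁} {r₂} p·q≈α p·r≈α = trans
    (solve 6 (λ a b q₁ q₂ r₁ r₂ → a :* (q₁ :- r₁) :+ b :* (q₂ :- r₂) :=
       a :* q₁ :+ b :* q₂ :- (a :* r₁ :+ b :* r₂)) refl a b q₁ q₂ r₁ r₂)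
    (x≈y⇒x-y≈0 (trans p·q≈α (sym p·r≈α)))

  -- If the larger coordinate vanished, both would, and the dot product would be 0 instead of `α`.
  positive-coordinate : ∀ {α a b q₁ q₂} → 0# < α → 0# ≤ a → a ≤ b → a * q₁ + b * q₂ ≈ α → 0# < b
  positive-coordinate {α} {a} {b} {q₁} {q₂} 0<α 0≤a a≤b p·q≈α = ≤-trans 0≤a a≤b ,
    λ 0≈b → proj₂ 0<α (begin
      0#                   ≈⟨ solve 2 (λ q₁ q₂ → con (+ 0) := con (+ 0) :* q₁ :+ con (+ 0) :* q₂) refl q₁ q₂ ⟩
      0# * q₁ + 0# * q₂    ≈⟨ +-cong (*-congʳ (≤-antisym 0≤a (≤-respʳ (sym 0≈b) a≤b))) (*-congʳ 0≈b) ⟩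
      a * q₁ + b * q₂      ≈⟨ p·q≈α ⟩
      α                    ∎)
    where open SetoidReasoning setoid

  -- The difference of two points on the line of p is D p^⊥ / α, where D is their
  -- determinant; hence D ≠ 0 for distinct points, and they determine p.
  two-points : ∀ {α} → 0# < α → ∀ {p p′ q r} → q ≉ₚ r →
               p · q ≈ α → p · r ≈ α → p′ · q ≈ α → p′ · r ≈ α → p ≈ₚ p′
  two-points {α} 0<α {p} {p′} {q₁ , q₂} {r₁ , r₂} q≉r p·q p·r p′·q p′·r = by-cases (D ≟ 0#)
    where
    open SetoidReasoning setoid
    D : ℝ
    D = q₁ * r₂ - q₂ * r₁

    difference₁ : ∀ a b → a * q₁ + b * q₂ ≈ α → a * r₁ + b * r₂ ≈ α → α * (q₁ - r₁) ≈ D * b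
    difference₁ a b onq onr = begin
      α * (q₁ - r₁)
        ≈⟨ solve 3 (λ α q₁ r₁ → α :* (q₁ :- r₁) := α :* q₁ :- α :* r₁) refl α q₁ r₁ ⟩
      α * q₁ - α * r₁
        -- `α` is replaced by `p · r` in the first product and by `p · q` in the second, so that the
        -- terms with `a` cancel.
        ≈⟨ +-cong (*-congʳ onr) (-‿cong (*-congʳ onq)) ⟨
      (a * r₁ + b * r₂) * q₁ - (a * q₁ + b * q₂) * r₁
        ≈⟨ solve 6 (λ a b q₁ q₂ r₁ r₂ →
             (a :* r₁ :+ b :* r₂) :* q₁ :- (a :* q₁ :+ b :* q₂) :* r₁ :=
             (q₁ :* r₂ :- q₂ :* r₁) :* b) refl a b q₁ q₂ r₁ r₂ ⟩
      D * b ∎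

    difference₂ : ∀ a b → a * q₁ + b * q₂ ≈ α → a * r₁ + b * r₂ ≈ α → α * (r₂ - q₂) ≈ D * a
    difference₂ a b onq onr = begin
      α * (r₂ - q₂)
        ≈⟨ solve 3 (λ α q₂ r₂ → α :* (r₂ :- q₂) := α :* r₂ :- α :* q₂) refl α q₂ r₂ ⟩
      α * r₂ - α * q₂
        ≈⟨ +-cong (*-congʳ onq) (-‿cong (*-congʳ onr)) ⟨
      (a * q₁ + b * q₂) * r₂ - (a * r₁ + b * r₂) * q₂
        ≈⟨ solve 6 (λ a b q₁ q₂ r₁ r₂ →
             (a :* q₁ :+ b :* q₂) :* r₂ :- (a :* r₁ :+ b :* r₂) :* q₂ :=
             (q₁ :* r₂ :- q₂ :* r₁) :* a) refl a b q₁ q₂ r₁ r₂ ⟩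
      D * a ∎

    cancel-D : ∀ {x y z} → D ≉ 0# → z ≈ D * x → z ≈ D * y → x ≈ y
    cancel-D {x} {y} D≉0 z≈Dx z≈Dy = x-y≈0⇒x≈y (x*y≈0⇒y≈0 D≉0
      (trans (solve 3 (λ D x y → D :* (x :- y) := D :* x :- D :* y) refl D x y)
             (x≈y⇒x-y≈0 (trans (sym z≈Dx) z≈Dy))))

    cancel-α : ∀ {x y} c → D ≈ 0# → α * (x - y) ≈ D * c → x ≈ y
    cancel-α c D≈0 h = x-y≈0⇒x≈y (x*y≈0⇒y≈0 (0<x⇒x≉0 0<α) (trans h (trans (*-congʳ D≈0) (zeroˡ c))))

    by-cases : Dec (D ≈ 0#) → p ≈ₚ p′
    by-cases (yes D≈0) = contradiction
      (cancel-α (proj₂ p) D≈0 (difference₁ _ _ p·q p·r) ,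
       sym (cancel-α (proj₁ p) D≈0 (difference₂ _ _ p·q p·r))) q≉r
    by-cases (no D≉0)  =
      cancel-D D≉0 (difference₂ _ _ p·q p·r) (difference₂ _ _ p′·q p′·r) ,
      cancel-D D≉0 (difference₁ _ _ p·q p·r) (difference₁ _ _ p′·q p′·r)

  -- Distance at most √2/M, squared and cleared of the denominator.
  Close : ℕ → Point × Point → Set
  Close M (q , r) = fromℕ M * fromℕ M * ((q -ₚ r) · (q -ₚ r)) ≤ fromℕ 2

  close? : ∀ M → Decidable (Close M)
  close? M (q , r) = fromℕ M * fromℕ M * ((q -ₚ r) · (q -ₚ r)) ≤? fromℕ 2

  -- The line of p is cut along the axis to which it makes an angle of at most 45°.
  coordinate : Point → Point → ℝ
  coordinate (p₁ , p₂) (q₁ , q₂) with p₁ ≤? p₂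
  ... | yes _ = q₁
  ... | no _  = q₂

  strip : ℕ → Point → Point → ℕ
  strip M p q = cell M (fromℕ M * coordinate p q)

  module _ (M : ℕ) where

    private
      M² : ℝ
      M² = fromℕ M * fromℕ M

    same-cell-scaled : ∀ {x y} → 0# ≤ x × x ≤ 1# → 0# ≤ y × y ≤ 1# →
                       cell M (fromℕ M * x) ≡ cell M (fromℕ M * y) → M² * ((x - y) * (x - y)) ≤ 1#
    same-cell-scaled {x} {y} (0≤x , x≤1) (0≤y , y≤1) same =
      ≤-respˡ (solve 3 (λ m x y → (m :* x :- m :* y) :* (m :* x :- m :* y) :=
                                  m :* m :* ((x :- y) :* (x :- y))) refl (fromℕ M) x y)
        (same-cell M (scale-nonNeg 0≤x) (scale-≤ x≤1) (scale-nonNeg 0≤y) (scale-≤ y≤1) same)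
      where
      scale-nonNeg : ∀ {x} → 0# ≤ x → 0# ≤ fromℕ M * x
      scale-nonNeg = *-nonNeg (fromℕ-nonNeg M)
      scale-≤ : ∀ {x} → x ≤ 1# → fromℕ M * x ≤ fromℕ M
      scale-≤ x≤1 = ≤-respʳ (*-identityʳ _) (*-monoˡ-≤ (fromℕ-nonNeg M) x≤1)

    scaled-sum : ∀ {u v} → M² * (u * u) ≤ 1# → M² * (v * v) ≤ 1# → M² * (u * u + v * v) ≤ fromℕ 2
    scaled-sum {u} {v} ≤u ≤v = ≤-by (+-nonNeg (x≤y⇒0≤y-x ≤u) (x≤y⇒0≤y-x ≤v))
      (solve 3 (λ n u v → con (+ 2) := n :* (u :* u :+ v :* v)
          :+ (con (+ 1) :- n :* (u :* u) :+ (con (+ 1) :- n :* (v :* v)))) refl M² u v)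

    -- A common strip bounds the difference along the cut axis by 1/M. The difference along the
    -- other axis is no larger by `orthogonal-≤`.
    same-strip⇒close : ∀ {α} → 0# < α → ∀ {p q r} → InUnitSquare p → InUnitSquare q → InUnitSquare r →
                       p · q ≈ α → p · r ≈ α → strip M p q ≡ strip M p r → Close M (q , r)
    same-strip⇒close 0<α {p₁ , p₂} ((0≤p₁ , _) , (0≤p₂ , _)) (q₁∈ , q₂∈) (r₁∈ , r₂∈) p·q p·r same
      with p₁ ≤? p₂
    ... | yes p₁≤p₂ = scaled-sum ≤u (≤-trans (*-monoˡ-≤ (0≤x² (fromℕ M)) v²≤u²) ≤u)
      where
      ≤u = same-cell-scaled q₁∈ r₁∈ same
      v²≤u² = orthogonal-≤ 0≤p₁ p₁≤p₂ (positive-coordinate 0<α 0≤p₁ p₁≤p₂ p·q) (orthogonal p·q p·r)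
    ... | no p₁≰p₂ = scaled-sum (≤-trans (*-monoˡ-≤ (0≤x² (fromℕ M)) u²≤v²) ≤v) ≤v
      where
      p₂≤p₁ = ≰⇒≥ p₁≰p₂
      ≤v = same-cell-scaled q₂∈ r₂∈ same
      u²≤v² = orthogonal-≤ 0≤p₂ p₂≤p₁
                (positive-coordinate 0<α 0≤p₂ p₂≤p₁ (trans (+-comm _ _) p·q))
                (trans (+-comm _ _) (orthogonal p·q p·r))

  dist-energy : ∀ {s} M → 1 ℕ.≤ M → 0# ≤ s → 0# ≤ fromℕ 2 - s → ∀ {q r} → q ≉ₚ r → Close M (q , r) →
                exp (s * log (fromℕ M) - log (fromℕ 2)) ≤ dist q r ^ (- s)
  dist-energy {s} M 1≤M 0≤s 0≤2-s {q} {r} q≉r close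
    with (q -ₚ r) · (q -ₚ r) ≤? 0#
  -- This is the branch where `√_` takes its default value 0; a sum of two squares that is not
  -- positive forces `q ≈ₚ r`.
  ... | yes D≤0 = contradiction (q≈r q r D≤0) q≉r
    where
    square-zero : ∀ {u v} → u * u + v * v ≤ 0# → u ≈ 0#
    square-zero {u} {v} ≤0 with u ≟ 0#
    ... | yes u≈0 = u≈0
    ... | no u≉0  = x*y≈0⇒y≈0 u≉0 (≤-antisym
      (≤-trans (≤-by (0≤x² v) refl) ≤0) (0≤x² u))
    q≈r : ∀ q r → (q -ₚ r) · (q -ₚ r) ≤ 0# → q ≈ₚ r
    q≈r q r ≤0 = x-y≈0⇒x≈y (square-zero ≤0) ,
                 x-y≈0⇒x≈y (square-zero (≤-respˡ (+-comm _ _) ≤0))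
  -- Here the distance is exp (½ log D), so `log-exp` reduces its logarithm to ½ log D.
  ... | no D≰0 = exp-mono (≤-respʳ (*-congˡ (sym (log-exp _)))
      (distance-exponent 2*½≈1 (⁻¹-nonNeg (fromℕ-pos {2} (ℕ.s≤s ℕ.z≤n))) 0≤log2 0≤s 0≤2-s log-close))
    where
    D m λ′ : ℝ
    D  = (q -ₚ r) · (q -ₚ r)
    m  = log (fromℕ M)
    λ′ = log D
    0<D : 0# < D
    0<D = ≰⇒≥ D≰0 , λ 0≈D → D≰0 (≤-reflexive (sym 0≈D))
    log-close : m + m + λ′ ≤ log (fromℕ 2)
    log-close = exp-cancel-≤ (≤-respˡ
      (sym (trans (exp-+ (m + m) λ′) (*-cong (trans (exp-+ m m) (*-cong (exp-fromℕ 1≤M) (exp-fromℕ 1≤M)))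
        (exp-log 0<D))))
      (≤-respʳ (sym (exp-fromℕ {2} (ℕ.s≤s ℕ.z≤n))) close))

-- From incidences and energy to the number of triples.

module Assembly (reals : Reals) where
  open Reals reals hiding (zero)
  open RealGeometry reals
  open ExpLog reals
  open Exponents completeOrderedField
  open Geometry reals
  open Counting
  open Mult semiring using (×-homo-+; ×1-homo-*)

  incidences : ℝ → List Point → Point → ℕ
  incidences α ps p = ∑[ q ← ps ] 𝟙 (p · q ≟ α)

  closePairs : ℕ → FinitePointSet → ℕ
  closePairs M P = length (filter (close? M) (distinctPairs P))

  all-in-square : ∀ {ps} → (∀ p → p ∈ₚ ps → InUnitSquare p) → All InUnitSquare ps
  all-in-square {[]}     _  = []
  all-in-square {p ∷ ps} h = h p (here (Setoid.refl pointSetoid)) ∷ all-in-square λ q q∈ps → h q (there q∈ps)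

  ∑-incidences² : ∀ {α} → 0# < α → ∀ M → 1 ℕ.≤ M → (P : FinitePointSet) → All InUnitSquare (points P) →
    (∑[ p ← points P ] (incidences α (points P) p ℕ.* incidences α (points P) p)) ℕ.≤
    size P ℕ.* (M ℕ.* M) ℕ.+ 2 ℕ.* M ℕ.* closePairs M P
  ∑-incidences² {α} 0<α M 1≤M P in-square = Strips.∑-richness² pointDecSetoid (λ p q → p · q ≟ α)
    (close? M) {InUnitSquare} M (strip M) (λ _ _ → cell<M M 1≤M)
    (λ p∈ q∈ r∈ → same-strip⇒close M 0<α p∈ q∈ r∈) (two-points 0<α) (unique P) in-square

  -- For fixed `p` the conditions on `q` and `r` are independent, so the count of pairs factors.
  length-Π : ∀ α β P → length (Π α β P) ≡
             (∑[ p ← points P ] (incidences α (points P) p ℕ.* incidences β (points P) p))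
  length-Π α β P = begin
    length (Π α β P)
      ≡⟨ length-filter _ (cartesianProduct ps (cartesianProduct ps ps)) ⟩
    ∑ (cartesianProduct ps (cartesianProduct ps ps)) (λ (p , q , r) → 𝟙 ((p · q ≟ α) ×-dec (p · r ≟ β)))
      ≡⟨ ∑-cartesianProduct ps (cartesianProduct ps ps) _ ⟩
    (∑[ p ← ps ] ∑ (cartesianProduct ps ps) (λ (q , r) → 𝟙 ((p · q ≟ α) ×-dec (p · r ≟ β))))
      ≡⟨ ∑-cong ps (λ p → ≡.trans (∑-cartesianProduct ps ps _) (≡.trans
           (∑-cong ps λ q → ∑-cong ps λ r → 𝟙-× (p · q ≟ α) (p · r ≟ β))
           (≡.sym (∑-* ps ps (λ q → 𝟙 (p · q ≟ α)) (λ r → 𝟙 (p · r ≟ β)))))) ⟩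
    (∑[ p ← ps ] (incidences α ps p ℕ.* incidences β ps p)) ∎
    where
    open ≡ₚ.≡-Reasoning
    ps : List Point
    ps = points P

  length-Π-≤ : ∀ {α β} → 0# < α → 0# < β → ∀ M → 1 ℕ.≤ M → (P : FinitePointSet) →
    All InUnitSquare (points P) →
    length (Π α β P) ℕ.≤ 2 ℕ.* (size P ℕ.* (M ℕ.* M) ℕ.+ 2 ℕ.* (M ℕ.* closePairs M P))
  length-Π-≤ {α} {β} 0<α 0<β M 1≤M P in-square = begin
    length (Π α β P)                                        ≡⟨ length-Π α β P ⟩
    (∑[ p ← ps ] (a p ℕ.* b p))                             ≤⟨ ∑-mono ps (λ p → m*n≤m²+n² (a p) (b p)) ⟩
    (∑[ p ← ps ] (a p ℕ.* a p ℕ.+ b p ℕ.* b p))             ≡⟨ ∑-+ ps _ _ ⟩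
    (∑[ p ← ps ] (a p ℕ.* a p)) ℕ.+ (∑[ p ← ps ] (b p ℕ.* b p))
      ≤⟨ ℕₚ.+-mono-≤ (∑-incidences² 0<α M 1≤M P in-square) (∑-incidences² 0<β M 1≤M P in-square) ⟩
    bound ℕ.+ bound                                         ≡⟨ double (size P) M (closePairs M P) ⟩
    2 ℕ.* (size P ℕ.* (M ℕ.* M) ℕ.+ 2 ℕ.* (M ℕ.* closePairs M P)) ∎
    where
    open ℕₚ.≤-Reasoning
    ps : List Point
    ps = points P
    a b : Point → ℕ
    a = incidences α ps
    b = incidences β ps
    bound : ℕ
    bound = size P ℕ.* (M ℕ.* M) ℕ.+ 2 ℕ.* M ℕ.* closePairs M P
    double : ∀ n m e → (n ℕ.* (m ℕ.* m) ℕ.+ 2 ℕ.* m ℕ.* e) ℕ.+ (n ℕ.* (m ℕ.* m) ℕ.+ 2 ℕ.* m ℕ.* e)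
             ≡ 2 ℕ.* (n ℕ.* (m ℕ.* m) ℕ.+ 2 ℕ.* (m ℕ.* e))
    double = solve-∀

  -- Markov's inequality: terms outside `Q` are dropped since `f` is non-negative. The lower bound
  -- is asked only on the list, whose members may carry further information such as distinctness.
  sum-≥-count : ∀ {A : Set} {Q : Pred A 0ℓ} (Q? : Decidable Q) {c} {f : A → ℝ} →
                (∀ x → 0# ≤ f x) → ∀ {xs} → All (λ x → Q x → c ≤ f x) xs →
                fromℕ (length (filter Q? xs)) * c ≤ sum (map f xs)
  sum-≥-count Q? 0≤f []                = ≤-reflexive (zeroˡ _)
  sum-≥-count Q? {c} 0≤f (_∷_ {x} h hs) with Q? x
  ... | yes Qx = ≤-respˡ (sym (trans (distribʳ c 1# _) (+-congʳ (*-identityˡ c))))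
                   (+-mono-≤ (h Qx) (sum-≥-count Q? 0≤f hs))
  ... | no _   = ≤-respˡ (+-identityˡ _) (+-mono-≤ (0≤f x) (sum-≥-count Q? 0≤f hs))

  -- The exponential is Mˢ/2. By `dist-energy` each close pair contributes at least this much to the
  -- energy sum, which is at most K times the binomial coefficient.
  closePairs-energy : ∀ {s K n P} M → 1 ℕ.≤ M → 0# ≤ s → 0# ≤ fromℕ 2 - s → 0# ≤ K → 2 ℕ.≤ n →
    IsAdaptable s K n P →
    fromℕ (closePairs M P) * exp (s * log (fromℕ M) - log (fromℕ 2)) ≤ K * (fromℕ n * fromℕ n)
  closePairs-energy {s} {K} {n} {P} M 1≤M 0≤s 0≤2-s 0≤K 2≤n adaptable = ≤-trans
    (sum-≥-count (close? M) (λ _ → exp-nonNeg _)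
      (All.map (dist-energy M 1≤M 0≤s 0≤2-s) (all-filter _ (cartesianProduct (points P) (points P)))))
    (≤-trans energy≤ (*-monoˡ-≤ 0≤K
      (≤-respʳ (×1-homo-* n n) (fromℕ-mono (nC2≤n² n)))))
    where
    E : ℝ
    E = sum (map (uncurry λ p q → dist p q ^ (- s)) (distinctPairs P))
    B : ℝ
    B = fromℕ (n C 2)
    0<B : 0# < B
    0<B = fromℕ-pos (nC2>0 2≤n)
    energy≤ : E ≤ K * B
    energy≤ = ≤-respˡ B*B⁻¹*E≈E (≤-respʳ (*-comm B K)
      (*-monoˡ-≤ (proj₁ 0<B) (IsAdaptable.energy adaptable)))
      where
      B*B⁻¹*E≈E : B * (B ⁻¹ * E) ≈ E
      B*B⁻¹*E≈E = trans (sym (*-assoc _ _ _))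
        (trans (*-congʳ (⁻¹-inverseʳ B (0<x⇒x≉0 0<B))) (*-identityˡ E))

  -- The choice of M near the cube root of n, and the final constant.

  module _ {s K : ℝ} (1≤s : 1# ≤ s) (s≤2 : s ≤ fromℕ 2) (0<K : 0# < K) where

    private
      0<s : 0# < s
      0<s = <-≤-trans (0≤1 , 0≉1) 1≤s
      0<3 : 0# < fromℕ 3
      0<3 = fromℕ-pos {3} (ℕ.s≤s ℕ.z≤n)
      γ ℓ : ℝ
      γ = fromℕ 4 / fromℕ 3 + 1# / s
      ℓ = log (fromℕ 2)

      s*1/s≈1 : s * (1# / s) ≈ 1#
      s*1/s≈1 = trans (*-congˡ (*-identityˡ _)) (⁻¹-inverseʳ s (0<x⇒x≉0 0<s))
      3*⅓≈1 : fromℕ 3 * fromℕ 3 ⁻¹ ≈ 1#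
      3*⅓≈1 = ⁻¹-inverseʳ _ (0<x⇒x≉0 0<3)
      0≤1/s : 0# ≤ 1# / s
      0≤1/s = *-nonNeg 0≤1 (⁻¹-nonNeg 0<s)

    module _ {n M : ℕ} (2≤n : 2 ℕ.≤ n) (1≤M : 1 ℕ.≤ M) (M³≤n : cube M ℕ.≤ n) (n<[1+M]³ : n ℕ.< cube (suc M))
      where

      private
        L m : ℝ
        L = log (fromℕ n)
        m = log (fromℕ M)
        1≤n : 1 ℕ.≤ n
        1≤n = ℕₚ.<⇒≤ 2≤n

        exp-cube : ∀ k → 1 ℕ.≤ k → let κ = log (fromℕ k) in exp (κ + κ + κ) ≈ fromℕ (cube k)
        exp-cube k 1≤k = begin
          exp (κ + κ + κ)              ≈⟨ trans (exp-+ _ _) (*-congʳ (exp-+ _ _)) ⟩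
          exp κ * exp κ * exp κ        ≈⟨ *-cong (*-cong e e) e ⟩
          fromℕ k * fromℕ k * fromℕ k  ≈⟨ trans (×1-homo-* (k ℕ.* k) k) (*-congʳ (×1-homo-* k k)) ⟨
          fromℕ (cube k)               ∎
          where
          open SetoidReasoning setoid
          κ : ℝ
          κ = log (fromℕ k)
          e : exp κ ≈ fromℕ k
          e = exp-fromℕ 1≤k

        3m≤L : m + m + m ≤ L
        3m≤L = exp-cancel-≤ (≤-respˡ (sym (exp-cube M 1≤M))
          (≤-respʳ (sym (exp-fromℕ 1≤n)) (fromℕ-mono M³≤n)))

        -- Since M ≥ 1, n < (M + 1)³ ≤ (2M)³; then logarithms are taken.
        L≤3[m+ℓ] : L ≤ fromℕ 3 * (m + ℓ)
        L≤3[m+ℓ] = exp-cancel-≤ (≤-respˡ (sym (exp-fromℕ 1≤n)) (≤-respʳ (sym exp≈)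
          (fromℕ-mono (ℕₚ.≤-trans (ℕₚ.<⇒≤ n<[1+M]³) (cube-mono 1+M≤M*2)))))
          where
          1+M≤M*2 : suc M ℕ.≤ M ℕ.* 2
          1+M≤M*2 = ℕₚ.≤-trans (ℕₚ.+-monoˡ-≤ M 1≤M) (ℕₚ.≤-reflexive (double M))
            where
            double : ∀ k → k ℕ.+ k ≡ k ℕ.* 2
            double = solve-∀
          exp≈ : exp (fromℕ 3 * (m + ℓ)) ≈ fromℕ (cube (M ℕ.* 2))
          exp≈ = begin
            exp (fromℕ 3 * (m + ℓ))
              ≈⟨ exp-cong (solve 2 (λ m ℓ → con (+ 3) :* (m :+ ℓ) := (m :+ m :+ m) :+ (ℓ :+ ℓ :+ ℓ)) refl m ℓ) ⟩
            exp ((m + m + m) + (ℓ + ℓ + ℓ))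
              ≈⟨ trans (exp-+ _ _) (*-cong (exp-cube M 1≤M) (exp-cube 2 (ℕ.s≤s ℕ.z≤n))) ⟩
            fromℕ (cube M) * fromℕ (cube 2)
              ≈⟨ ×1-homo-* (cube M) (cube 2) ⟨
            fromℕ (cube M ℕ.* cube 2)
              ≡⟨ ≡.cong fromℕ (cube-* M) ⟩
            fromℕ (cube (M ℕ.* 2)) ∎
            where
            open SetoidReasoning setoid
            cube-* : ∀ k → k ℕ.* k ℕ.* k ℕ.* 8 ≡ k ℕ.* 2 ℕ.* (k ℕ.* 2) ℕ.* (k ℕ.* 2)
            cube-* = solve-∀

      poor-≤ : fromℕ (n ℕ.* (M ℕ.* M)) ≤ fromℕ n ^ γ
      poor-≤ = ≤-respˡ exp≈ (exp-mono (poor-exponent s*1/s≈1 3*⅓≈1 0≤1/s (⁻¹-nonNeg 0<3)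
        (x≤y⇒0≤y-x 1≤s) (x≤y⇒0≤y-x s≤2) (0≤log 1≤n) 3m≤L))
        where
        exp≈ : exp (L + (m + m)) ≈ fromℕ (n ℕ.* (M ℕ.* M))
        exp≈ = begin
          exp (L + (m + m))              ≈⟨ trans (exp-+ _ _) (*-congˡ (exp-+ _ _)) ⟩
          exp L * (exp m * exp m)        ≈⟨ *-cong (exp-fromℕ 1≤n) (*-cong (exp-fromℕ 1≤M) (exp-fromℕ 1≤M)) ⟩
          fromℕ n * (fromℕ M * fromℕ M)  ≈⟨ trans (×1-homo-* n (M ℕ.* M)) (*-congˡ (×1-homo-* M M)) ⟨
          fromℕ (n ℕ.* (M ℕ.* M))        ∎
          where open SetoidReasoning setoid

      -- The energy estimate is multiplied by exp (m - w) = 2 M^(1 - s), which turns the factor Mˢ/2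
      -- into M. The 4 is the exponential of the term `ℓ + ℓ` in `energy-exponent`.
      closePairs-≤ : ∀ {P} → IsAdaptable s K n P →
                     fromℕ (M ℕ.* closePairs M P) ≤ K * (fromℕ n ^ γ * fromℕ 4)
      closePairs-≤ {P} adaptable = ≤-respˡ split (≤-trans
        (*-monoʳ-≤ (exp-nonNeg _)
          (closePairs-energy M 1≤M (proj₁ 0<s) (x≤y⇒0≤y-x s≤2) (proj₁ 0<K) 2≤n adaptable))
        (≤-respˡ (sym collect) (*-monoˡ-≤ (proj₁ 0<K) (≤-respʳ exp≈ (exp-mono
          (energy-exponent s*1/s≈1 3*⅓≈1 0≤1/s (⁻¹-nonNeg 0<3)
            (x≤y⇒0≤y-x 1≤s) (x≤y⇒0≤y-x s≤2) (0≤log 1≤n) 0≤log2 L≤3[m+ℓ]))))))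
        where
        open SetoidReasoning setoid
        C w : ℝ
        C = fromℕ (closePairs M P)
        w = s * m - ℓ
        split : C * exp w * exp (m - w) ≈ fromℕ (M ℕ.* closePairs M P)
        split = begin
          C * exp w * exp (m - w)        ≈⟨ *-assoc _ _ _ ⟩
          C * (exp w * exp (m - w))      ≈⟨ *-congˡ (exp-split w m) ⟨
          C * exp m                      ≈⟨ *-congˡ (exp-fromℕ 1≤M) ⟩
          C * fromℕ M                    ≈⟨ *-comm _ _ ⟩
          fromℕ M * C                    ≈⟨ ×1-homo-* M (closePairs M P) ⟨
          fromℕ (M ℕ.* closePairs M P)   ∎
        collect : K * (fromℕ n * fromℕ n) * exp (m - w) ≈ K * exp (L + L + (m - w))
        collect = begin
          K * (fromℕ n * fromℕ n) * exp (m - w)    ≈⟨ *-assoc _ _ _ ⟩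
          K * (fromℕ n * fromℕ n * exp (m - w))
            ≈⟨ *-congˡ (*-congʳ (*-cong (exp-fromℕ 1≤n) (exp-fromℕ 1≤n))) ⟨
          K * (exp L * exp L * exp (m - w))        ≈⟨ *-congˡ (trans (exp-+ _ _) (*-congʳ (exp-+ _ _))) ⟨
          K * exp (L + L + (m - w))                ∎
        exp≈ : exp (γ * L + (ℓ + ℓ)) ≈ fromℕ n ^ γ * fromℕ 4
        exp≈ = begin
          exp (γ * L + (ℓ + ℓ))          ≈⟨ trans (exp-+ _ _) (*-congˡ (exp-+ _ _)) ⟩
          exp (γ * L) * (exp ℓ * exp ℓ)  ≈⟨ *-congˡ (*-cong e e) ⟩
          exp (γ * L) * (fromℕ 2 * fromℕ 2)  ≈⟨ *-congˡ (×1-homo-* 2 2) ⟨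
          exp (γ * L) * fromℕ 4          ∎
          where
          e : exp ℓ ≈ fromℕ 2
          e = exp-fromℕ {2} (ℕ.s≤s ℕ.z≤n)

    -- With G = n^γ the count is at most 2 (G + 2 · 4 K G) = (2 + 16 K) G; the factor 2 log n ≥ 1
    -- then doubles the constant.
    length-Π-bound : ∀ {α β n P} → 0# < α → 0# < β → 2 ℕ.≤ n → IsAdaptable s K n P →
      fromℕ (length (Π α β P)) ≤ (fromℕ 4 + fromℕ 32 * K) * fromℕ n ^ γ * log (fromℕ n)
    length-Π-bound {α} {β} {n} {P} 0<α 0<β 2≤n adaptable
      with M , 1≤M , M³≤n , n<[1+M]³ ← cubeRoot n (ℕₚ.<⇒≤ 2≤n) = ≤-trans
        (≤-respʳ homo (fromℕ-mono (≡.subst (λ k → length (Π α β P) ℕ.≤ 2 ℕ.* (k ℕ.* (M ℕ.* M) ℕ.+ 2 ℕ.* (M ℕ.* E)))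
          (IsAdaptable.size≡n adaptable)
          (length-Π-≤ 0<α 0<β M 1≤M P (all-in-square (IsAdaptable.inUnitSquare adaptable))))))
        (≤-by (+-nonNeg (+-nonNeg
            (*-nonNeg (fromℕ-nonNeg 2) (x≤y⇒0≤y-x (poor-≤ 2≤n 1≤M M³≤n n<[1+M]³)))
            (*-nonNeg (fromℕ-nonNeg 4) (x≤y⇒0≤y-x (closePairs-≤ 2≤n 1≤M M³≤n n<[1+M]³ adaptable))))
            (*-nonNeg (*-nonNeg (+-nonNeg (fromℕ-nonNeg 2) (*-nonNeg (fromℕ-nonNeg 16) (proj₁ 0<K))) (exp-nonNeg _))
                      (x≤y⇒0≤y-x (1≤2*log 2≤n))))
          (solve 5 (λ a b K G L →
            (con (+ 4) :+ con (+ 32) :* K) :* G :* L :=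
            con (+ 2) :* (a :+ con (+ 2) :* b)
              :+ (con (+ 2) :* (G :- a) :+ con (+ 4) :* (K :* (G :* con (+ 4)) :- b)
                  :+ (con (+ 2) :+ con (+ 16) :* K) :* G :* (con (+ 2) :* L :- con (+ 1))))
            refl (fromℕ (n ℕ.* (M ℕ.* M))) (fromℕ (M ℕ.* E)) K (fromℕ n ^ γ) (log (fromℕ n))))
      where
      E = closePairs M P
      homo : fromℕ (2 ℕ.* (n ℕ.* (M ℕ.* M) ℕ.+ 2 ℕ.* (M ℕ.* E))) ≈
             fromℕ 2 * (fromℕ (n ℕ.* (M ℕ.* M)) + fromℕ 2 * fromℕ (M ℕ.* E))
      homo = trans (×1-homo-* 2 (n ℕ.* (M ℕ.* M) ℕ.+ 2 ℕ.* (M ℕ.* E))) (*-congˡ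
        (trans (×-homo-+ 1# (n ℕ.* (M ℕ.* M)) (2 ℕ.* (M ℕ.* E))) (+-congˡ (×1-homo-* 2 (M ℕ.* E)))))

theorem3 : (reals : Reals) →
    let open Reals reals
        open RealGeometry reals
    in
    (s α β K : ℝ) →
    fromℕ 3 / fromℕ 2 < s → s ≤ fromℕ 2 →
    0# < α → 0# < β → 0# < K →
    (I : Pred ℕ 0ℓ) → Infinite I →
    (P : (n : ℕ) → n ∈ I → FinitePointSet) →
    ((n : ℕ) (n∈I : n ∈ I) → IsAdaptable s K n (P n n∈I)) →
    ∃[ C ] ∃[ N ] (0# < C × 0 ℕ.< N ×
      ((n : ℕ) (n∈I : n ∈ I) → N ℕ.< n →
        fromℕ (length (Π α β (P n n∈I)))
          ≤ C * fromℕ n ^ (fromℕ 4 / fromℕ 3 + 1# / s) * log (fromℕ n)))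
theorem3 reals s α β K 3/2<s s≤2 0<α 0<β 0<K I _ P adaptable =
  -- `N = 1` makes n at least 2, so that the binomial coefficient is positive and 2 log n ≥ 1.
  fromℕ 4 + fromℕ 32 * K , 1 , 0<C , ℕ.s≤s ℕ.z≤n ,
  λ n n∈I 2≤n → length-Π-bound 1≤s s≤2 0<K 0<α 0<β 2≤n (adaptable n n∈I)
  where
  open Reals reals hiding (zero)
  open RealGeometry reals
  open ExpLog reals
  open Assembly reals
  0<C : 0# < fromℕ 4 + fromℕ 32 * K
  0<C = <-≤-trans (fromℕ-pos {4} (ℕ.s≤s ℕ.z≤n)) (≤-by (*-nonNeg (fromℕ-nonNeg 32) (proj₁ 0<K)) refl)
  1≤s : 1# ≤ s
  -- Modulo 2 · ½ = 1, the lower bound 3 · ½ equals 1 + ½.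
  1≤s = ≤-trans (≤-by-mod 1# (⁻¹-nonNeg (fromℕ-pos {2} (ℕ.s≤s ℕ.z≤n))) 2*½≈1
    (solve 1 (λ h → con (+ 3) :* h :=
      con (+ 1) :+ h :+ con (+ 1) :* (con (+ 2) :* h :- con (+ 1))) refl ½)) (proj₁ 3/2<s)
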